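{- Let $0<p<1$ and let $X_1,\ldots,X_n$ be independent random variables, each following the same distribution as a random variable $X\sim b(p)$. Let $S_n=\sum_{i=1}^n X_i$. Then, for any $r$ such that $p<r<1$, $$P(S_n\ge rn)\le \exp\left(-D(r\|p)\,n\right)=\left[\left(\frac{p}{r}\right)^r\left(\frac{1-p}{1-r}\right)^{1-r}\right]^n .$$
   Context: $b(p)$ denotes the Bernoulli distribution with $P(X=1)=p$, $P(X=0)=1-p$. For $r,p\in(0,1)$, $D(r\|p)$ is the Kullback-Leibler divergence between the two-point distributions $(r,1-r)$ and $(p,1-p)$, i.e. $D(r\|p)=r\ln\frac{r}{p}+(1-r)\ln\frac{1-r}{1-p}$. Here $n\ge 1$ is an integer. -}

module Defs where

open import Level using (0ℓ; suc)
open import Algebra.Bundles using (CommutativeRing; Semiring)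
open import Axiom.ExcludedMiddle using (ExcludedMiddle)
open import Data.Fin.Base using (Fin; toℕ)
open import Data.Nat.Base as ℕ using (ℕ; _!)
open import Data.Product.Base using (_×_; _,_; ∃-syntax)
open import Relation.Binary.Core using (Rel)
open import Relation.Binary.PropositionalEquality.Core using (_≢_)
open import Relation.Binary.Structures using (IsTotalOrder)
open import Relation.Nullary.Decidable.Core using (yes; no)
open import Relation.Nullary.Negation.Core using (¬_)
open import Relation.Unary using (Pred; _∈_; _≐_; ∁; U; ⋃; _⊢_; Satisfiable; _⊥_)
import Algebra.Definitions.RawSemiring as RawSemiringDefinitions
import Relation.Binary.Construct.NonStrictToStrict as ToStrict

-- The library has no type of real numbers.  These are the second-order axioms
-- for ℝ: classically, any two models are related by a unique isomorphism of
-- ordered fields.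
record CompleteOrderedField : Set (suc 0ℓ) where
  field
    commutativeRing : CommutativeRing 0ℓ 0ℓ

  open CommutativeRing commutativeRing public

  infix 8 _⁻¹
  infix 4 _≤_

  field
    -- Total, as is usual; nothing is assumed about the value at 0#.
    _⁻¹          : Carrier → Carrier
    _≤_          : Rel Carrier 0ℓ
    0≉1          : ¬ (0# ≈ 1#)
    ⁻¹-inverseʳ  : ∀ x → ¬ (x ≈ 0#) → x * x ⁻¹ ≈ 1#
    isTotalOrder : IsTotalOrder _≈_ _≤_
    +-monoˡ-≤    : ∀ x {y z} → y ≤ z → y + x ≤ z + x
    *-nonNeg     : ∀ {x y} → 0# ≤ x → 0# ≤ y → 0# ≤ x * y

  IsUpperBound : Pred Carrier 0ℓ → Pred Carrier 0ℓ
  IsUpperBound A u = ∀ x → x ∈ A → x ≤ u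

  field
    complete : ∀ A → Satisfiable A → Satisfiable (IsUpperBound A) →
               ∃[ s ] (s ∈ IsUpperBound A × (∀ u → u ∈ IsUpperBound A → s ≤ u))

  open ToStrict _≈_ _≤_ public using (_<_)
  open RawSemiringDefinitions (Semiring.rawSemiring semiring) public
    using (sum; product; _^_) renaming (_×_ to _·_)

  infixl 7 _/_
  _/_ : Carrier → Carrier → Carrier
  x / y = x * y ⁻¹

  fromℕ : ℕ → Carrier
  fromℕ n = n · 1#

  ∑< : ℕ → (ℕ → Carrier) → Carrier
  ∑< n a = sum {n} (λ i → a (toℕ i))

  infix 4 _⟶_
  _⟶_ : (ℕ → Carrier) → Carrier → Set
  a ⟶ l = ∀ ε → 0# < ε →
    ∃[ N ] (∀ n → N ℕ.≤ n → l - ε < a n × a n < l + ε)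

-- Excluded middle is used to define a limit without a proof of convergence and
-- a logarithm without a proof that exp is onto the positive numbers.
module Analysis (em : ExcludedMiddle 0ℓ) (ℝ : CompleteOrderedField) where
  open CompleteOrderedField ℝ

  -- Zero if there is no limit.
  lim : (ℕ → Carrier) → Carrier
  lim a with em {∃[ l ] (a ⟶ l)}
  ... | yes (l , _) = l
  ... | no  _       = 0#

  exp : Carrier → Carrier
  exp x = lim (λ N → ∑< N (λ k → x ^ k / fromℕ (k !)))

  -- Zero if x is not a value of exp, that is, if x is not positive.
  ln : Carrier → Carrier
  ln x with em {∃[ y ] (exp y ≈ x)}
  ... | yes (y , _) = y
  ... | no  _       = 0#

  -- Real power; meaningful for a positive base only.
  infixr 8 _^ᴿ_
  _^ᴿ_ : Carrier → Carrier → Carrier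
  x ^ᴿ y = exp (y * ln x)

  D[_∥_] : Carrier → Carrier → Carrier
  D[ r ∥ p ] = r * ln (r / p) + (1# - r) * ln ((1# - r) / (1# - p))

module Probability (ℝ : CompleteOrderedField) where
  open CompleteOrderedField ℝ

  data Borel : Pred Carrier 0ℓ → Set (suc 0ℓ) where
    ray        : ∀ a → Borel (λ x → x ≤ a)
    complement : ∀ {A} → Borel A → Borel (∁ A)
    union      : (A : ℕ → Pred Carrier 0ℓ) → (∀ i → Borel (A i)) → Borel (⋃ ℕ A)
    resp       : ∀ {A B} → A ≐ B → Borel A → Borel B

  record ProbabilitySpace : Set (suc (suc 0ℓ)) where
    field
      Ω : Set

      -- The σ-algebra.  Predicates stand for subsets, so closure under
      -- extensional equality has to be required.
      Event            : Pred Ω 0ℓ → Set (suc 0ℓ)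
      Event-U          : Event U
      Event-complement : ∀ {A} → Event A → Event (∁ A)
      Event-union      : (A : ℕ → Pred Ω 0ℓ) → (∀ i → Event (A i)) → Event (⋃ ℕ A)
      Event-resp       : ∀ {A B} → A ≐ B → Event A → Event B

      -- Total for convenience; its values outside the σ-algebra are arbitrary.
      P         : Pred Ω 0ℓ → Carrier
      P-cong    : ∀ {A B} → Event A → A ≐ B → P A ≈ P B
      P-nonNeg  : ∀ {A} → Event A → 0# ≤ P A
      P-U       : P U ≈ 1#
      P-σ-additive : (A : ℕ → Pred Ω 0ℓ) → (∀ i → Event (A i)) →
                     (∀ i j → i ≢ j → A i ⊥ A j) →
                     (λ n → ∑< n (λ i → P (A i))) ⟶ P (⋃ ℕ A)

  module _ (𝒫 : ProbabilitySpace) where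
    open ProbabilitySpace 𝒫

    IsRandomVariable : (Ω → Carrier) → Set (suc 0ℓ)
    IsRandomVariable X = ∀ {B} → Borel B → Event (X ⊢ B)

    -- X ∼ b(p)
    IsBernoulli : Carrier → (Ω → Carrier) → Set
    IsBernoulli p X = P (λ ω → X ω ≈ 1#) ≈ p × P (λ ω → X ω ≈ 0#) ≈ 1# - p

    -- Taking some of the B i to be the whole line gives the product formula for
    -- every subfamily.
    Independent : ∀ {n} → (Fin n → Ω → Carrier) → Set (suc 0ℓ)
    Independent {n} X = (B : Fin n → Pred Carrier 0ℓ) → (∀ i → Borel (B i)) →
      P (λ ω → ∀ i → X i ω ∈ B i) ≈ product (λ i → P (X i ⊢ B i))

{-# OPTIONS --safe #-}
-- For s ∈ {0,1}ⁿ with k ones, the event X = s has probability pᵏ(1-p)ⁿ⁻ᵏ, which is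
-- rᵏ(1-r)ⁿ⁻ᵏ times (p/r)ᵏ((1-p)/(1-r))ⁿ⁻ᵏ.  Since p < r, the second factor decreases
-- in k and so is at most exp(-D(r‖p)n) as soon as k ≥ rn; the first factors add up to
-- 1 over all s.
--
-- The power series exp is multiplicative because the square partial sums of the
-- product series differ from the triangular ones by at most the same difference
-- for ∣x∣ and ∣y∣, where it tends to zero.  It takes every positive value y, namely
-- at the supremum of {x : exp x ≤ y}, because 1-h ≤ exp(-h) for h ≥ 0.
module Submission where

-- Comparing `b(p)` with `b(r)` cell by cell turns the bound into finitely many inequalities between
-- weights, so that on the probability side only additivity, monotonicity and independence for
-- singletons enter. Two obstacles remain there. A variable with law `b(p)` on an arbitrary `Ω`
-- takes the values 0 and 1 only almost surely, so the cells `X = s` do not cover `Ω`, and what they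
-- miss must be shown to have probability zero at each splitting. Also `P` is constrained on events
-- only, so `r n ≤ S` must itself be an event; this forces measurability of sums, hence countably
-- many rationals dense in the field, hence the Archimedean property from completeness. On the
-- analytic side `lim` and `ln` have default values, so nothing can be said about `exp` before its
-- series converges everywhere, nor about `ln` before `exp` is onto the positive numbers. The
-- estimate `expₙ n x * (1# - x) ≤ 1#` starts both: at one half it bounds the partial sums, and in
-- the limit it yields `1# - x ≤ exp (- x)`.

open import Defs
open import Level using (0ℓ)
open import Algebra.Bundles using (CommutativeRing; RawRing)
open import Algebra.Solver.Ring.AlmostCommutativeRing using (fromCommutativeRing; _-Raw-AlmostCommutative⟶_)
open import Axiom.DoubleNegationElimination using (em⇒dne)
open import Axiom.ExcludedMiddle using (ExcludedMiddle)
open import Data.Bool.Base using (Bool; true; false)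
open import Data.Empty using (⊥-elim)
open import Data.Fin.Base using (Fin; zero; suc; toℕ)
open import Data.Maybe.Base using (Maybe; just; nothing)
open import Data.Nat.Base as ℕ using (ℕ; NonZero; zero; suc; z≤n; s≤s; _!)
open import Data.Product.Base using (_×_; _,_; ∃-syntax; proj₁; proj₂)
open import Data.Sum.Base using (_⊎_; inj₁; inj₂)
open import Data.Vec.Functional using (_∷_)
open import Function.Base using (_∘_)
open import Relation.Binary.Bundles using (Poset)
open import Relation.Binary.PropositionalEquality.Core as ≡ using (_≡_; _≢_)
open import Relation.Binary.Structures using (IsTotalOrder)
open import Relation.Nullary.Decidable.Core using (yes; no)
open import Relation.Nullary.Negation.Core using (¬_)
open import Relation.Unary using (Pred; _⊆_; ∁; U; ∅; _∪_; _∩_; _⊥_)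
import Algebra.Properties.Ring as RingProperties
import Algebra.Properties.Semiring.Exp as Exp
import Algebra.Properties.Semiring.Mult as Mult
import Algebra.Properties.Semiring.Mult.TCOptimised as MultTC
import Algebra.Properties.Semiring.Sum as Sum
import Algebra.Solver.Ring as RingSolver
import Data.Nat.Properties as ℕ
import Relation.Binary.Reasoning.PartialOrder as ≤-Reasoning
import Relation.Binary.Reasoning.Setoid as SetoidReasoning

-- Ring solver with integer coefficients.

-- Integers are represented as formal differences of naturals, which spares the
-- homomorphism proof a case analysis on signs.
module IntegerCoefficients (R : CommutativeRing 0ℓ 0ℓ) where
  open CommutativeRing R
  open RingProperties ring
  open MultTC semiring renaming (_×_ to _·_)
  open SetoidReasoning setoid

  -- The solver compares normal forms syntactically, so differences are kept in
  -- lowest terms.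
  reduce : ℕ → ℕ → ℕ × ℕ
  reduce a b = a ℕ.∸ b , b ℕ.∸ a

  differences : RawRing 0ℓ 0ℓ
  differences = record
    { Carrier = ℕ × ℕ
    ; _≈_     = _≡_
    ; _+_     = λ (a , b) (c , d) → reduce (a ℕ.+ c) (b ℕ.+ d)
    ; _*_     = λ (a , b) (c , d) → reduce (a ℕ.* c ℕ.+ b ℕ.* d) (a ℕ.* d ℕ.+ b ℕ.* c)
    ; -_      = λ (a , b) → b , a
    ; 0#      = 0 , 0
    ; 1#      = 1 , 0
    }

  private
    [_] : ℕ → Carrier
    [ n ] = n · 1#

    -- The first clause makes the numerals (n , 0) evaluate to n · 1# on the nose.
    ⟦_⟧ : ℕ × ℕ → Carrier
    ⟦ a , zero  ⟧ = [ a ]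
    ⟦ a , suc b ⟧ = [ a ] - [ suc b ]

    ⟦⟧-difference : ∀ a b → ⟦ a , b ⟧ ≈ [ a ] - [ b ]
    ⟦⟧-difference a zero    = begin
      [ a ]          ≈⟨ +-identityʳ _ ⟨
      [ a ] + 0#     ≈⟨ +-congˡ -0#≈0# ⟨
      [ a ] - 0#     ∎
    ⟦⟧-difference a (suc b) = refl

    interchange : ∀ a b c d → (a + b) + (c + d) ≈ (a + c) + (b + d)
    interchange a b c d = begin
      (a + b) + (c + d)  ≈⟨ +-assoc _ _ _ ⟩
      a + (b + (c + d))  ≈⟨ +-congˡ (+-assoc _ _ _) ⟨
      a + ((b + c) + d)  ≈⟨ +-congˡ (+-congʳ (+-comm _ _)) ⟩
      a + ((c + b) + d)  ≈⟨ +-congˡ (+-assoc _ _ _) ⟩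
      a + (c + (b + d))  ≈⟨ +-assoc _ _ _ ⟨
      (a + c) + (b + d)  ∎

    difference-+ : ∀ a b c d → (a + c) - (b + d) ≈ (a - b) + (c - d)
    difference-+ a b c d = begin
      (a + c) - (b + d)        ≈⟨ +-congˡ (-‿+-comm b d) ⟨
      (a + c) + (- b - d)      ≈⟨ interchange a c (- b) (- d) ⟩
      (a - b) + (c - d)        ∎

    difference-* : ∀ a b c d → (a * c + b * d) - (a * d + b * c) ≈ (a - b) * (c - d)
    difference-* a b c d = begin
      (a * c + b * d) - (a * d + b * c)          ≈⟨ difference-+ _ _ _ _ ⟩
      (a * c - a * d) + (b * d - b * c)          ≈⟨ +-cong (+-congˡ (-‿distribʳ-* a d)) (+-comm _ _) ⟩
      (a * c + a * - d) + (- (b * c) + b * d)    ≈⟨ +-cong (distribˡ a c (- d)) (+-cong (sym (-‿distribˡ-* b c)) lemma) ⟨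
      a * (c - d) + (- b * c + - b * - d)        ≈⟨ +-congˡ (distribˡ (- b) c (- d)) ⟨
      a * (c - d) + - b * (c - d)                ≈⟨ distribʳ (c - d) a (- b) ⟨
      (a - b) * (c - d)                          ∎
      where
      lemma : - b * - d ≈ b * d
      lemma = begin
        - b * - d     ≈⟨ -‿distribˡ-* b (- d) ⟨
        - (b * - d)   ≈⟨ -‿cong (-‿distribʳ-* b d) ⟨
        - - (b * d)   ≈⟨ -‿involutive _ ⟩
        b * d         ∎

    -- The hypothesis is equality in the group of differences. Adding `[ d ]` to both parts of the
    -- left difference and `[ b ]` to both parts of the right one makes them agree term by term.
    difference-cong : ∀ a b c d → a ℕ.+ d ≡ c ℕ.+ b → [ a ] - [ b ] ≈ [ c ] - [ d ]
    difference-cong a b c d eq = begin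
      [ a ] - [ b ]                        ≈⟨ cancelled a b d ⟨
      [ a ℕ.+ d ] - ([ b ] + [ d ])        ≈⟨ +-cong (reflexive (≡.cong [_] eq)) (-‿cong (+-comm _ _)) ⟩
      [ c ℕ.+ b ] - ([ d ] + [ b ])        ≈⟨ cancelled c d b ⟩
      [ c ] - [ d ]                        ∎
      where
      cancelled : ∀ a b d → [ a ℕ.+ d ] - ([ b ] + [ d ]) ≈ [ a ] - [ b ]
      cancelled a b d = begin
        [ a ℕ.+ d ] - ([ b ] + [ d ])        ≈⟨ +-congʳ (×-homo-+ 1# a d) ⟩
        ([ a ] + [ d ]) - ([ b ] + [ d ])    ≈⟨ difference-+ _ _ _ _ ⟩
        ([ a ] - [ b ]) + ([ d ] - [ d ])    ≈⟨ +-congˡ (-‿inverseʳ _) ⟩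
        ([ a ] - [ b ]) + 0#                 ≈⟨ +-identityʳ _ ⟩
        [ a ] - [ b ]                        ∎

    ⟦reduce⟧ : ∀ a b → ⟦ reduce a b ⟧ ≈ [ a ] - [ b ]
    ⟦reduce⟧ a b = trans (⟦⟧-difference (a ℕ.∸ b) (b ℕ.∸ a)) (difference-cong _ _ a b (balanced a b))
      where
      balanced : ∀ a b → a ℕ.∸ b ℕ.+ b ≡ a ℕ.+ (b ℕ.∸ a)
      balanced zero    b       = ≡.cong (ℕ._+ b) (ℕ.0∸n≡0 b)
      balanced (suc a) zero    = ≡.refl
      balanced (suc a) (suc b) = ≡.trans (ℕ.+-suc (a ℕ.∸ b) b) (≡.cong suc (balanced a b))

  homomorphism : differences -Raw-AlmostCommutative⟶ fromCommutativeRing R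
  homomorphism = record
    { ⟦_⟧    = ⟦_⟧
    ; +-homo = λ (a , b) (c , d) → begin
        ⟦ reduce (a ℕ.+ c) (b ℕ.+ d) ⟧     ≈⟨ ⟦reduce⟧ (a ℕ.+ c) (b ℕ.+ d) ⟩
        [ a ℕ.+ c ] - [ b ℕ.+ d ]          ≈⟨ +-cong (×-homo-+ 1# a c) (-‿cong (×-homo-+ 1# b d)) ⟩
        ([ a ] + [ c ]) - ([ b ] + [ d ])  ≈⟨ difference-+ _ _ _ _ ⟩
        ([ a ] - [ b ]) + ([ c ] - [ d ])  ≈⟨ +-cong (⟦⟧-difference a b) (⟦⟧-difference c d) ⟨
        ⟦ a , b ⟧ + ⟦ c , d ⟧              ∎
    ; *-homo = λ (a , b) (c , d) → begin
        ⟦ reduce (a ℕ.* c ℕ.+ b ℕ.* d) (a ℕ.* d ℕ.+ b ℕ.* c) ⟧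
          ≈⟨ ⟦reduce⟧ (a ℕ.* c ℕ.+ b ℕ.* d) (a ℕ.* d ℕ.+ b ℕ.* c) ⟩
        [ a ℕ.* c ℕ.+ b ℕ.* d ] - [ a ℕ.* d ℕ.+ b ℕ.* c ]
          ≈⟨ +-cong (products a c b d) (-‿cong (products a d b c)) ⟩
        ([ a ] * [ c ] + [ b ] * [ d ]) - ([ a ] * [ d ] + [ b ] * [ c ])
          ≈⟨ difference-* _ _ _ _ ⟩
        ([ a ] - [ b ]) * ([ c ] - [ d ])
          ≈⟨ *-cong (⟦⟧-difference a b) (⟦⟧-difference c d) ⟨
        ⟦ a , b ⟧ * ⟦ c , d ⟧ ∎
    ; -‿homo = λ (a , b) → begin
        ⟦ b , a ⟧          ≈⟨ ⟦⟧-difference b a ⟩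
        [ b ] - [ a ]      ≈⟨ +-congʳ (-‿involutive _) ⟨
        - - [ b ] - [ a ]  ≈⟨ -‿+-comm _ _ ⟩
        - (- [ b ] + [ a ])  ≈⟨ -‿cong (+-comm _ _) ⟩
        - ([ a ] - [ b ])  ≈⟨ -‿cong (⟦⟧-difference a b) ⟨
        - ⟦ a , b ⟧        ∎
    ; 0-homo = refl
    ; 1-homo = refl
    }
    where
    products : ∀ a c b d → [ a ℕ.* c ℕ.+ b ℕ.* d ] ≈ [ a ] * [ c ] + [ b ] * [ d ]
    products a c b d = trans (×-homo-+ 1# (a ℕ.* c) (b ℕ.* d)) (+-cong (×1-homo-* a c) (×1-homo-* b d))

  _≟_ : ∀ x y → Maybe (⟦ x ⟧ ≈ ⟦ y ⟧)
  (a , b) ≟ (c , d) with a ℕ.+ d ℕ.≟ c ℕ.+ b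
  ... | no  _  = nothing
  ... | yes eq = just (begin
    ⟦ a , b ⟧      ≈⟨ ⟦⟧-difference a b ⟩
    [ a ] - [ b ]  ≈⟨ difference-cong a b c d eq ⟩
    [ c ] - [ d ]  ≈⟨ ⟦⟧-difference c d ⟨
    ⟦ c , d ⟧      ∎)

module Solver (R : CommutativeRing 0ℓ 0ℓ) where
  private module Z = IntegerCoefficients R
  open RingSolver Z.differences (fromCommutativeRing R) Z.homomorphism Z._≟_ public
    using (Polynomial; con; solve; _:=_; _:+_; _:*_; _:-_; :-_)

  :0 :1 : ∀ {n} → Polynomial n
  :0 = con (0 , 0)
  :1 = con (1 , 0)

-- Order arithmetic and the Archimedean property.

module OrderedField (em : ExcludedMiddle 0ℓ) (ℝ : CompleteOrderedField) where
  open CompleteOrderedField ℝ public hiding (zero)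
  open Solver commutativeRing public
  open IsTotalOrder isTotalOrder public
    using (antisym; total; isPartialOrder)
    renaming (refl to ≤-refl; reflexive to ≤-reflexive; trans to ≤-trans)

  poset : Poset 0ℓ 0ℓ 0ℓ
  poset = record { isPartialOrder = isPartialOrder }

  open ≤-Reasoning poset public
  open RingProperties ring public using (-0#≈0#)

  <⇒≤ : ∀ {x y} → x < y → x ≤ y
  <⇒≤ = proj₁

  ≤⇒≯ : ∀ {x y} → x ≤ y → ¬ (y < x)
  ≤⇒≯ x≤y (y≤x , y≉x) = y≉x (antisym y≤x x≤y)

  ≤-<-connex : ∀ x y → x ≤ y ⊎ y < x
  ≤-<-connex x y with em {x ≤ y}
  ... | yes x≤y = inj₁ x≤y
  ... | no  x≰y with total x y
  ...   | inj₁ x≤y = ⊥-elim (x≰y x≤y)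
  ...   | inj₂ y≤x = inj₂ (y≤x , λ y≈x → x≰y (≤-reflexive (sym y≈x)))

  ≮⇒≥ : ∀ {x y} → ¬ (y < x) → x ≤ y
  ≮⇒≥ {x} {y} y≮x with ≤-<-connex x y
  ... | inj₁ x≤y = x≤y
  ... | inj₂ y<x = ⊥-elim (y≮x y<x)

  <⇒≉ : ∀ {x y} → x < y → ¬ (y ≈ x)
  <⇒≉ (_ , x≉y) y≈x = x≉y (sym y≈x)

  <-trans : ∀ {x y z} → x < y → y < z → x < z
  <-trans {x} {y} {z} x<y y<z = begin-strict
    x  <⟨ x<y ⟩
    y  <⟨ y<z ⟩
    z  ∎

  x≤y⇒0≤y-x : ∀ {x y} → x ≤ y → 0# ≤ y - x
  x≤y⇒0≤y-x {x} {y} x≤y = begin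
    0#     ≈⟨ -‿inverseʳ x ⟨
    x - x  ≤⟨ +-monoˡ-≤ (- x) x≤y ⟩
    y - x  ∎

  -- Linear and polynomial inequalities are proved by writing y - x as an
  -- evidently nonnegative expression d.
  ≤-by : ∀ {x y} d → 0# ≤ d → y - x ≈ d → x ≤ y
  ≤-by {x} {y} d 0≤d y-x≈d = begin
    x            ≈⟨ +-identityˡ x ⟨
    0# + x       ≤⟨ +-monoˡ-≤ x 0≤d ⟩
    d + x        ≈⟨ +-congʳ y-x≈d ⟨
    (y - x) + x  ≈⟨ solve 2 (λ x y → (y :- x) :+ x := y) refl x y ⟩
    y            ∎

  <-by : ∀ {x y} d → 0# < d → y - x ≈ d → x < y
  <-by {x} {y} d (0≤d , 0≉d) y-x≈d = ≤-by d 0≤d y-x≈d , λ x≈y →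
    0≉d (trans (sym (trans (+-congʳ (sym x≈y)) (-‿inverseʳ x))) y-x≈d)

  x<y⇒0<y-x : ∀ {x y} → x < y → 0# < y - x
  x<y⇒0<y-x {x} {y} (x≤y , x≉y) = x≤y⇒0≤y-x x≤y , λ 0≈y-x → x≉y (begin-equality
    x            ≈⟨ +-identityˡ x ⟨
    0# + x       ≈⟨ +-congʳ 0≈y-x ⟩
    (y - x) + x  ≈⟨ solve 2 (λ x y → (y :- x) :+ x := y) refl x y ⟩
    y            ∎)

  +-nonNeg : ∀ {x y} → 0# ≤ x → 0# ≤ y → 0# ≤ x + y
  +-nonNeg {x} {y} 0≤x 0≤y = begin
    0#      ≤⟨ 0≤y ⟩
    y       ≈⟨ +-identityˡ y ⟨
    0# + y  ≤⟨ +-monoˡ-≤ y 0≤x ⟩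
    x + y   ∎

  +-pos-nonNeg : ∀ {x y} → 0# < x → 0# ≤ y → 0# < x + y
  +-pos-nonNeg {x} {y} 0<x 0≤y = begin-strict
    0#      <⟨ 0<x ⟩
    x       ≤⟨ ≤-by y 0≤y (solve 2 (λ x y → (x :+ y) :- x := y) refl x y) ⟩
    x + y   ∎

  +-mono-≤ : ∀ {w x y z} → w ≤ x → y ≤ z → w + y ≤ x + z
  +-mono-≤ {w} {x} {y} {z} w≤x y≤z =
    ≤-by _ (+-nonNeg (x≤y⇒0≤y-x w≤x) (x≤y⇒0≤y-x y≤z))
      (solve 4 (λ w x y z → (x :+ z) :- (w :+ y) := (x :- w) :+ (z :- y)) refl w x y z)

  *-monoʳ-≤ : ∀ {x y z} → 0# ≤ x → y ≤ z → x * y ≤ x * z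
  *-monoʳ-≤ {x} {y} {z} 0≤x y≤z =
    ≤-by _ (*-nonNeg 0≤x (x≤y⇒0≤y-x y≤z))
      (solve 3 (λ x y z → (x :* z) :- (x :* y) := x :* (z :- y)) refl x y z)

  *-monoˡ-≤ : ∀ {x y z} → 0# ≤ x → y ≤ z → y * x ≤ z * x
  *-monoˡ-≤ {x} {y} {z} 0≤x y≤z = begin
    y * x  ≈⟨ *-comm y x ⟩
    x * y  ≤⟨ *-monoʳ-≤ 0≤x y≤z ⟩
    x * z  ≈⟨ *-comm x z ⟩
    z * x  ∎

  -‿mono-≤ : ∀ {x y} → x ≤ y → - y ≤ - x
  -‿mono-≤ {x} {y} x≤y = ≤-by _ (x≤y⇒0≤y-x x≤y)
    (solve 2 (λ x y → (:- x) :- (:- y) := y :- x) refl x y)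

  0≤x² : ∀ x → 0# ≤ x * x
  0≤x² x with total 0# x
  ... | inj₁ 0≤x = *-nonNeg 0≤x 0≤x
  ... | inj₂ x≤0 = ≤-by _ (*-nonNeg (x≤y⇒0≤y-x x≤0) (x≤y⇒0≤y-x x≤0))
        (solve 1 (λ x → x :* x :- :0 := (:0 :- x) :* (:0 :- x)) refl x)

  0≤1 : 0# ≤ 1#
  0≤1 = begin
    0#       ≤⟨ 0≤x² 1# ⟩
    1# * 1#  ≈⟨ *-identityʳ 1# ⟩
    1#       ∎

  0<1 : 0# < 1#
  0<1 = 0≤1 , 0≉1

  0<1+x : ∀ {x} → 0# ≤ x → 0# < 1# + x
  0<1+x = +-pos-nonNeg 0<1

  x*x⁻¹≈1 : ∀ {x} → 0# < x → x * x ⁻¹ ≈ 1#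
  x*x⁻¹≈1 {x} 0<x = ⁻¹-inverseʳ x (<⇒≉ 0<x)

  ⁻¹-unique : ∀ {x y} → 0# < x → x * y ≈ 1# → y ≈ x ⁻¹
  ⁻¹-unique {x} {y} 0<x xy≈1 = begin-equality
    y               ≈⟨ *-identityʳ y ⟨
    y * 1#          ≈⟨ *-congˡ (x*x⁻¹≈1 0<x) ⟨
    y * (x * x ⁻¹)  ≈⟨ solve 3 (λ x y z → y :* (x :* z) := (x :* y) :* z) refl x y (x ⁻¹) ⟩
    (x * y) * x ⁻¹  ≈⟨ *-congʳ xy≈1 ⟩
    1# * x ⁻¹       ≈⟨ *-identityˡ _ ⟩
    x ⁻¹            ∎

  0<x⁻¹ : ∀ {x} → 0# < x → 0# < x ⁻¹
  0<x⁻¹ {x} 0<x = ≮⇒≥ x⁻¹≮0 , λ 0≈x⁻¹ → 0≉1 (begin-equality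
    0#        ≈⟨ zeroʳ x ⟨
    x * 0#    ≈⟨ *-congˡ 0≈x⁻¹ ⟩
    x * x ⁻¹  ≈⟨ x*x⁻¹≈1 0<x ⟩
    1#        ∎)
    where
    x⁻¹≮0 : ¬ (x ⁻¹ < 0#)
    x⁻¹≮0 (x⁻¹≤0 , _) = ≤⇒≯ 1≤0 0<1
      where
      1≤0 : 1# ≤ 0#
      1≤0 = begin
        1#        ≈⟨ x*x⁻¹≈1 0<x ⟨
        x * x ⁻¹  ≤⟨ *-monoʳ-≤ (<⇒≤ 0<x) x⁻¹≤0 ⟩
        x * 0#    ≈⟨ zeroʳ x ⟩
        0#        ∎

  x⁻¹*[x*y]≈y : ∀ {x} y → 0# < x → x ⁻¹ * (x * y) ≈ y
  x⁻¹*[x*y]≈y {x} y 0<x = begin-equality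
    x ⁻¹ * (x * y)  ≈⟨ solve 3 (λ x y z → z :* (x :* y) := x :* z :* y) refl x y (x ⁻¹) ⟩
    x * x ⁻¹ * y    ≈⟨ *-congʳ (x*x⁻¹≈1 0<x) ⟩
    1# * y          ≈⟨ *-identityˡ y ⟩
    y               ∎

  *-cancelˡ : ∀ {x y z} → 0# < x → x * y ≈ x * z → y ≈ z
  *-cancelˡ {x} {y} {z} 0<x xy≈xz = begin-equality
    y               ≈⟨ x⁻¹*[x*y]≈y y 0<x ⟨
    x ⁻¹ * (x * y)  ≈⟨ *-congˡ xy≈xz ⟩
    x ⁻¹ * (x * z)  ≈⟨ x⁻¹*[x*y]≈y z 0<x ⟩
    z               ∎

  *-cancelˡ-≤ : ∀ {x y z} → 0# < x → x * y ≤ x * z → y ≤ z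
  *-cancelˡ-≤ {x} {y} {z} 0<x xy≤xz = begin
    y               ≈⟨ x⁻¹*[x*y]≈y y 0<x ⟨
    x ⁻¹ * (x * y)  ≤⟨ *-monoʳ-≤ (<⇒≤ (0<x⁻¹ 0<x)) xy≤xz ⟩
    x ⁻¹ * (x * z)  ≈⟨ x⁻¹*[x*y]≈y z 0<x ⟩
    z               ∎

  *-pos : ∀ {x y} → 0# < x → 0# < y → 0# < x * y
  *-pos {x} {y} 0<x 0<y = *-nonNeg (<⇒≤ 0<x) (<⇒≤ 0<y) , λ 0≈xy →
    <⇒≉ 0<y (*-cancelˡ 0<x (trans (sym 0≈xy) (sym (zeroʳ x))))

  /-pos : ∀ {x y} → 0# < x → 0# < y → 0# < x / y
  /-pos 0<x 0<y = *-pos 0<x (0<x⁻¹ 0<y)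

  y*[x/y]≈x : ∀ x {y} → 0# < y → y * (x / y) ≈ x
  y*[x/y]≈x x {y} 0<y = begin-equality
    y * (x * y ⁻¹)  ≈⟨ solve 3 (λ x y z → y :* (x :* z) := x :* (y :* z)) refl x y (y ⁻¹) ⟩
    x * (y * y ⁻¹)  ≈⟨ *-congˡ (x*x⁻¹≈1 0<y) ⟩
    x * 1#          ≈⟨ *-identityʳ x ⟩
    x               ∎

  half : Carrier → Carrier
  half x = x / (1# + 1#)

  half+half : ∀ x → half x + half x ≈ x
  half+half x = begin-equality
    half x + half x      ≈⟨ solve 1 (λ h → h :+ h := (:1 :+ :1) :* h) refl (half x) ⟩
    (1# + 1#) * half x   ≈⟨ y*[x/y]≈x x (0<1+x 0≤1) ⟩
    x                    ∎

  half-pos : ∀ {x} → 0# < x → 0# < half x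
  half-pos 0<x = /-pos 0<x (0<1+x 0≤1)

  half<x : ∀ {x} → 0# < x → half x < x
  half<x {x} 0<x = <-by (half x) (half-pos 0<x) (begin-equality
    x - half x                   ≈⟨ +-congʳ (half+half x) ⟨
    (half x + half x) - half x   ≈⟨ solve 1 (λ h → (h :+ h) :- h := h) refl (half x) ⟩
    half x                       ∎)

  0≤fromℕ : ∀ n → 0# ≤ fromℕ n
  0≤fromℕ zero    = ≤-refl
  0≤fromℕ (suc n) = +-nonNeg 0≤1 (0≤fromℕ n)

  0<fromℕ-suc : ∀ n → 0# < fromℕ (suc n)
  0<fromℕ-suc n = 0<1+x (0≤fromℕ n)

  -- Otherwise the naturals are bounded. The set `below` that they generate is closed under adding
  -- `1#`, so one less than its supremum would still be an upper bound.
  archimedean : ∀ x → ∃[ n ] (x < fromℕ n)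
  archimedean x with em {∃[ n ] (x < fromℕ n)}
  ... | yes p = p
  ... | no ¬p = ⊥-elim (≤⇒≯ (least (s - 1#) s-1-isUpperBound)
                  (<-by 1# 0<1 (solve 1 (λ s → s :- (s :- :1) := :1) refl s)))
    where
    below : Carrier → Set
    below y = ∃[ n ] (y ≤ fromℕ n)

    sup = complete below (0# , 0 , ≤-refl)
      (x , λ y (n , y≤n) → ≤-trans y≤n (≮⇒≥ (λ x<n → ¬p (n , x<n))))

    s     = proj₁ sup
    upper = proj₁ (proj₂ sup)
    least = proj₂ (proj₂ sup)

    s-1-isUpperBound : IsUpperBound below (s - 1#)
    s-1-isUpperBound y (n , y≤n) = ≤-by (s - (1# + y))
      (x≤y⇒0≤y-x (upper (1# + y) (suc n , +-mono-≤ ≤-refl y≤n)))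
      (solve 2 (λ s y → (s :- :1) :- y := s :- (:1 :+ y)) refl s y)

-- Bounds on absolute values, null sequences and limit laws.

module Limits (em : ExcludedMiddle 0ℓ) (ℝ : CompleteOrderedField) where
  open OrderedField em ℝ
  open Analysis em ℝ using (lim)

  infix 4 ∣_∣≤_
  -- A relation in place of an absolute value function: bounds combine by polynomial arithmetic,
  -- with no case split on signs.
  ∣_∣≤_ : Carrier → Carrier → Set
  ∣ x ∣≤ y = - y ≤ x × x ≤ y

  ∣∣-cong : ∀ {x x′ y} → x ≈ x′ → ∣ x ∣≤ y → ∣ x′ ∣≤ y
  ∣∣-cong x≈x′ (l , u) = ≤-trans l (≤-reflexive x≈x′) , ≤-trans (≤-reflexive (sym x≈x′)) u

  ∣∣-weaken : ∀ {x y z} → ∣ x ∣≤ y → y ≤ z → ∣ x ∣≤ z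
  ∣∣-weaken (l , u) y≤z = ≤-trans (-‿mono-≤ y≤z) l , ≤-trans u y≤z

  0≤∣∣ : ∀ {x y} → ∣ x ∣≤ y → 0# ≤ y
  0≤∣∣ {x} {y} (l , u) = ≮⇒≥ λ y<0 → ≤⇒≯ (≤-trans l u)
    (<-by (- y - y) (+-pos-nonNeg (0<-y y<0) (<⇒≤ (0<-y y<0)))
      refl)
    where
    0<-y : y < 0# → 0# < - y
    0<-y y<0 = <-by (0# - y) (x<y⇒0<y-x y<0) (solve 1 (λ y → (:- y) :- :0 := :0 :- y) refl y)

  nonNeg-∣∣ : ∀ {x} → 0# ≤ x → ∣ x ∣≤ x
  nonNeg-∣∣ {x} 0≤x = ≤-by (x + x) (+-nonNeg 0≤x 0≤x)
    (solve 1 (λ x → x :- (:- x) := x :+ x) refl x) , ≤-refl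

  ∣∣-neg : ∀ {x y} → ∣ x ∣≤ y → ∣ - x ∣≤ y
  ∣∣-neg {x} {y} (l , u) = -‿mono-≤ u ,
    ≤-trans (-‿mono-≤ l) (≤-reflexive (solve 1 (λ y → :- (:- y) := y) refl y))

  ∣∣-+ : ∀ {w x y z} → ∣ w ∣≤ x → ∣ y ∣≤ z → ∣ w + y ∣≤ x + z
  ∣∣-+ {w} {x} {y} {z} (l , u) (l′ , u′) =
    ≤-trans (≤-reflexive (solve 2 (λ x z → :- (x :+ z) := (:- x) :+ (:- z)) refl x z)) (+-mono-≤ l l′) ,
    +-mono-≤ u u′

  x+x-nonNeg⁻¹ : ∀ {x} → 0# ≤ x + x → 0# ≤ x
  x+x-nonNeg⁻¹ {x} 0≤2x = begin
    0#                        ≤⟨ *-nonNeg 0≤2x (<⇒≤ (half-pos 0<1)) ⟩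
    (x + x) * half 1#         ≈⟨ solve 2 (λ x h → (x :+ x) :* h := x :* (h :+ h)) refl x (half 1#) ⟩
    x * (half 1# + half 1#)   ≈⟨ *-congˡ (half+half 1#) ⟩
    x * 1#                    ≈⟨ *-identityʳ x ⟩
    x                         ∎

  -- The numbers `x + w`, `x - w`, `z + y`, `z - y` are nonnegative. The products of equal signs add
  -- up to twice `x * z + w * y`, those of opposite signs to twice `x * z - w * y`.
  ∣∣-* : ∀ {w x y z} → ∣ w ∣≤ x → ∣ y ∣≤ z → ∣ w * y ∣≤ x * z
  ∣∣-* {w} {x} {y} {z} (l , u) (l′ , u′) =
    ≤-by (w * y + x * z)
      (x+x-nonNeg⁻¹ (≤-trans (+-nonNeg (*-nonNeg 0≤x+w 0≤z+y) (*-nonNeg 0≤x-w 0≤z-y)) (≤-reflexive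
        (solve 4 (λ w x y z → (w :- (:- x)) :* (y :- (:- z)) :+ (x :- w) :* (z :- y) :=
          (w :* y :+ x :* z) :+ (w :* y :+ x :* z)) refl w x y z))))
      (solve 4 (λ w x y z → w :* y :- (:- (x :* z)) := w :* y :+ x :* z) refl w x y z) ,
    ≤-by (x * z - w * y)
      (x+x-nonNeg⁻¹ (≤-trans (+-nonNeg (*-nonNeg 0≤x-w 0≤z+y) (*-nonNeg 0≤x+w 0≤z-y)) (≤-reflexive
        (solve 4 (λ w x y z → (x :- w) :* (y :- (:- z)) :+ (w :- (:- x)) :* (z :- y) :=
          (x :* z :- w :* y) :+ (x :* z :- w :* y)) refl w x y z))))
      refl
    where
    0≤x+w = x≤y⇒0≤y-x l
    0≤x-w = x≤y⇒0≤y-x u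
    0≤z+y = x≤y⇒0≤y-x l′
    0≤z-y = x≤y⇒0≤y-x u′

  -- The extra `1#` keeps the bound positive even at zero, so that `Null-scale` can divide by it.
  ∣∣-bound : ∀ x → ∃[ y ] (0# < y × ∣ x ∣≤ y)
  ∣∣-bound x with total 0# x
  ... | inj₁ 0≤x = 1# + x , 0<1+x 0≤x , ∣∣-weaken (nonNeg-∣∣ 0≤x) (≤-by 1# 0≤1 (solve 1 (λ x → (:1 :+ x) :- x := :1) refl x))
  ... | inj₂ x≤0 = 1# - x , 0<1+x 0≤-x ,
    ∣∣-cong (solve 1 (λ x → :- (:- x) := x) refl x)
      (∣∣-neg (∣∣-weaken (nonNeg-∣∣ 0≤-x) (≤-by 1# 0≤1 (solve 1 (λ x → (:1 :- x) :- (:- x) := :1) refl x))))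
    where
    0≤-x : 0# ≤ - x
    0≤-x = ≤-trans (≤-reflexive (sym -0#≈0#)) (-‿mono-≤ x≤0)

  -- Convergence to zero with non-strict bounds. The limit laws are proved for the errors `a n - l`
  -- in this form and carried back by `Null⇒⟶`.
  Null : (ℕ → Carrier) → Set
  Null d = ∀ ε → 0# < ε → ∃[ N ] (∀ n → N ℕ.≤ n → ∣ d n ∣≤ ε)

  Null-resp : ∀ {c d} → (∀ n → c n ≈ d n) → Null c → Null d
  Null-resp c≈d c→0 ε 0<ε with N , small ← c→0 ε 0<ε = N , λ n N≤n → ∣∣-cong (c≈d n) (small n N≤n)

  Null-squeeze : ∀ {c d} → (∀ n → ∣ c n ∣≤ d n) → Null d → Null c
  Null-squeeze c≤d d→0 ε 0<ε with N , small ← d→0 ε 0<ε =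
    N , λ n N≤n → ∣∣-weaken (c≤d n) (proj₂ (small n N≤n))

  Null-neg : ∀ {c} → Null c → Null (λ n → - c n)
  Null-neg c→0 ε 0<ε with N , small ← c→0 ε 0<ε = N , λ n N≤n → ∣∣-neg (small n N≤n)

  Null-+ : ∀ {c d} → Null c → Null d → Null (λ n → c n + d n)
  Null-+ c→0 d→0 ε 0<ε
    with M , smallᶜ ← c→0 (half ε) (half-pos 0<ε) | N , smallᵈ ← d→0 (half ε) (half-pos 0<ε) =
    M ℕ.⊔ N , λ n M⊔N≤n → ∣∣-weaken
      (∣∣-+ (smallᶜ n (ℕ.m⊔n≤o⇒m≤o M N M⊔N≤n)) (smallᵈ n (ℕ.m⊔n≤o⇒n≤o M N M⊔N≤n)))
      (≤-reflexive (half+half ε))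

  Null-* : ∀ {c d} → Null c → Null d → Null (λ n → c n * d n)
  -- One factor within `ε` is enough once the other is within `1#`.
  Null-* c→0 d→0 ε 0<ε with M , smallᶜ ← c→0 ε 0<ε | N , smallᵈ ← d→0 1# 0<1 =
    M ℕ.⊔ N , λ n M⊔N≤n → ∣∣-weaken
      (∣∣-* (smallᶜ n (ℕ.m⊔n≤o⇒m≤o M N M⊔N≤n)) (smallᵈ n (ℕ.m⊔n≤o⇒n≤o M N M⊔N≤n)))
      (≤-reflexive (*-identityʳ ε))

  Null-scale : ∀ x {c} → Null c → Null (λ n → x * c n)
  Null-scale x c→0 ε 0<ε with y , 0<y , ∣x∣≤y ← ∣∣-bound x
    with N , small ← c→0 (ε / y) (/-pos 0<ε 0<y) =
    N , λ n N≤n → ∣∣-weaken (∣∣-* ∣x∣≤y (small n N≤n)) (≤-reflexive (y*[x/y]≈x ε 0<y))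

  Null-const : ∀ {x} → Null (λ _ → x) → x ≈ 0#
  Null-const {x} x→0 = antisym
    (≤0 (λ ε 0<ε → let N , small = x→0 ε 0<ε in proj₂ (small N ℕ.≤-refl)))
    (≤-trans (≤-reflexive (sym -0#≈0#)) (≤-trans (-‿mono-≤
      (≤0 (λ ε 0<ε → let N , small = x→0 ε 0<ε in proj₂ (∣∣-neg (small N ℕ.≤-refl)))))
      (≤-reflexive (solve 1 (λ y → :- (:- y) := y) refl x))))
    where
    ≤0 : ∀ {x} → (∀ ε → 0# < ε → x ≤ ε) → x ≤ 0#
    ≤0 {x} small = ≮⇒≥ λ 0<x → ≤⇒≯ (small (half x) (half-pos 0<x)) (half<x 0<x)

  ⟶⇒Null : ∀ {a l} → a ⟶ l → Null (λ n → a n - l)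
  ⟶⇒Null {a} {l} a→l ε 0<ε with N , near ← a→l ε 0<ε =
    N , λ n N≤n → let lower , upper = near n N≤n in
      ≤-by (a n - (l - ε)) (x≤y⇒0≤y-x (<⇒≤ lower))
        (solve 3 (λ a l ε → (a :- l) :- (:- ε) := a :- (l :- ε)) refl (a n) l ε) ,
      ≤-by ((l + ε) - a n) (x≤y⇒0≤y-x (<⇒≤ upper))
        (solve 3 (λ a l ε → ε :- (a :- l) := (l :+ ε) :- a) refl (a n) l ε)

  -- Halving `ε` leaves the room that turns non-strict bounds into strict ones.
  Null⇒⟶ : ∀ {a l} → Null (λ n → a n - l) → a ⟶ l
  Null⇒⟶ {a} {l} a-l→0 ε 0<ε with N , small ← a-l→0 (half ε) (half-pos 0<ε) =
    N , λ n N≤n → let lower , upper = small n N≤n in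
      (begin-strict
        l - ε             <⟨ <-by (ε - half ε) (x<y⇒0<y-x (half<x 0<ε))
                               (solve 3 (λ l ε h → (l :- h) :- (l :- ε) := ε :- h) refl l ε (half ε)) ⟩
        l - half ε        ≤⟨ ≤-by ((a n - l) - - half ε) (x≤y⇒0≤y-x lower)
                               (solve 3 (λ a l h → a :- (l :- h) := (a :- l) :- (:- h)) refl (a n) l (half ε)) ⟩
        a n               ∎) ,
      (begin-strict
        a n               ≤⟨ ≤-by (half ε - (a n - l)) (x≤y⇒0≤y-x upper)
                               (solve 3 (λ a l h → (l :+ h) :- a := h :- (a :- l)) refl (a n) l (half ε)) ⟩
        l + half ε        <⟨ <-by (ε - half ε) (x<y⇒0<y-x (half<x 0<ε))
                               (solve 3 (λ l ε h → (l :+ ε) :- (l :+ h) := ε :- h) refl l ε (half ε)) ⟩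
        l + ε             ∎)

  ⟶-unique : ∀ {a l m} → a ⟶ l → a ⟶ m → l ≈ m
  ⟶-unique {a} {l} {m} a→l a→m = begin-equality
    l            ≈⟨ solve 2 (λ l m → l := (l :- m) :+ m) refl l m ⟩
    (l - m) + m  ≈⟨ +-congʳ (Null-const (Null-resp
                      (λ n → solve 3 (λ a l m → (a :- m) :+ (:- (a :- l)) := l :- m) refl (a n) l m)
                      (Null-+ (⟶⇒Null a→m) (Null-neg (⟶⇒Null a→l))))) ⟩
    0# + m       ≈⟨ +-identityˡ m ⟩
    m            ∎

  ⟶-resp : ∀ {a b l m} → (∀ n → a n ≈ b n) → l ≈ m → a ⟶ l → b ⟶ m
  ⟶-resp a≈b l≈m a→l = Null⇒⟶ (Null-resp (λ n → +-cong (a≈b n) (-‿cong l≈m)) (⟶⇒Null a→l))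

  ⟶-eventually : ∀ {a l} N → (∀ n → N ℕ.≤ n → a n ≈ l) → a ⟶ l
  ⟶-eventually {a} {l} N a≈l = Null⇒⟶ λ ε 0<ε → N , λ n N≤n →
    ∣∣-cong (sym (trans (+-congʳ (a≈l n N≤n)) (-‿inverseʳ l)))
      (≤-trans (-‿mono-≤ (<⇒≤ 0<ε)) (≤-reflexive -0#≈0#) , <⇒≤ 0<ε)

  ⟶-sub : ∀ {a b l m} → a ⟶ l → b ⟶ m → (λ n → a n - b n) ⟶ l - m
  ⟶-sub {a} {b} {l} {m} a→l b→m = Null⇒⟶ (Null-resp
    (λ n → solve 4 (λ a b l m → (a :- l) :+ (:- (b :- m)) := (a :- b) :- (l :- m)) refl (a n) (b n) l m)
    (Null-+ (⟶⇒Null a→l) (Null-neg (⟶⇒Null b→m))))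

  ⟶-* : ∀ {a b l m} → a ⟶ l → b ⟶ m → (λ n → a n * b n) ⟶ l * m
  ⟶-* {a} {b} {l} {m} a→l b→m = Null⇒⟶ (Null-resp
    (λ n → solve 4 (λ a b l m → (a :- l) :* (b :- m) :+ (l :* (b :- m) :+ m :* (a :- l)) := a :* b :- l :* m)
             refl (a n) (b n) l m)
    (Null-+ (Null-* a-l→0 b-m→0) (Null-+ (Null-scale l b-m→0) (Null-scale m a-l→0))))
    where
    a-l→0 = ⟶⇒Null a→l
    b-m→0 = ⟶⇒Null b→m

  ⟶-≤ : ∀ {a l x} → a ⟶ l → (∀ n → a n ≤ x) → l ≤ x
  ⟶-≤ {a} {l} {x} a→l a≤x = ≮⇒≥ λ x<l →
    let N , near = a→l (l - x) (x<y⇒0<y-x x<l)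
    in ≤⇒≯ (a≤x N) (begin-strict
      x            ≈⟨ solve 2 (λ l x → x := l :- (l :- x)) refl l x ⟩
      l - (l - x)  <⟨ proj₁ (near N ℕ.≤-refl) ⟩
      a N          ∎)

  ⟶-≥ : ∀ {a l x} N → a ⟶ l → (∀ n → N ℕ.≤ n → x ≤ a n) → x ≤ l
  ⟶-≥ {a} {l} {x} M a→l x≤a = ≮⇒≥ λ l<x →
    let N , near = a→l (x - l) (x<y⇒0<y-x l<x)
    in ≤⇒≯ (x≤a (M ℕ.⊔ N) (ℕ.m≤m⊔n M N)) (begin-strict
      a (M ℕ.⊔ N)  <⟨ proj₂ (near (M ℕ.⊔ N) (ℕ.m≤n⊔m M N)) ⟩
      l + (x - l)  ≈⟨ solve 2 (λ l x → l :+ (x :- l) := x) refl l x ⟩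
      x            ∎)

  -- The limit is the supremum `s`. If no term exceeded `s - ε`, this would be a smaller upper
  -- bound; once one term does, monotonicity keeps all later terms above it.
  monotone-converges : ∀ {a x} → (∀ m n → m ℕ.≤ n → a m ≤ a n) → (∀ n → a n ≤ x) → ∃[ l ] (a ⟶ l)
  monotone-converges {a} {x} mono a≤x = s , Null⇒⟶ near
    where
    values : Carrier → Set
    values y = ∃[ n ] (y ≤ a n)

    sup = complete values (a 0 , 0 , ≤-refl) (x , λ y (n , y≤an) → ≤-trans y≤an (a≤x n))

    s     = proj₁ sup
    upper = proj₁ (proj₂ sup)
    least = proj₂ (proj₂ sup)

    near : Null (λ n → a n - s)
    near ε 0<ε with em {∃[ N ] (s - ε < a N)}
    ... | yes (N , s-ε<aN) = N , λ n N≤n →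
      ≤-by _ (x≤y⇒0≤y-x (≤-trans (<⇒≤ s-ε<aN) (mono N n N≤n)))
        (solve 3 (λ a s ε → (a :- s) :- (:- ε) := a :- (s :- ε)) refl (a n) s ε) ,
      ≤-by _ (+-nonNeg (<⇒≤ 0<ε) (x≤y⇒0≤y-x (upper (a n) (n , ≤-refl))))
        (solve 3 (λ a s ε → ε :- (a :- s) := ε :+ (s :- a)) refl (a n) s ε)
    ... | no none = ⊥-elim (≤⇒≯
      (least (s - ε) (λ y (n , y≤an) → ≤-trans y≤an (≮⇒≥ λ s-ε<an → none (n , s-ε<an))))
      (<-by ε 0<ε (solve 2 (λ s ε → s :- (s :- ε) := ε) refl s ε)))

  -- Convergence rules out the branch in which `lim` takes its default value.
  lim-limit : ∀ {a l} → a ⟶ l → a ⟶ lim a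
  lim-limit {a} {l} a→l with em {∃[ l ] (a ⟶ l)}
  ... | yes (_ , a→l′) = a→l′
  ... | no  none       = ⊥-elim (none (l , a→l))

-- Absolute convergence, Cauchy products and the Leibniz rule.

module Series (em : ExcludedMiddle 0ℓ) (ℝ : CompleteOrderedField) where
  open OrderedField em ℝ
  open Limits em ℝ
  open Sum semiring using (sum-cong-≋; ∑-distrib-+; *-distribˡ-sum)

  ∑<-cong : ∀ n {a b} → (∀ k → a k ≈ b k) → ∑< n a ≈ ∑< n b
  ∑<-cong n a≈b = sum-cong-≋ {n} (λ i → a≈b (toℕ i))

  ∑<-+ : ∀ n a b → ∑< n (λ k → a k + b k) ≈ ∑< n a + ∑< n b
  ∑<-+ n a b = ∑-distrib-+ {n} (a ∘ toℕ) (b ∘ toℕ)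

  ∑<-* : ∀ n x a → ∑< n (λ k → x * a k) ≈ x * ∑< n a
  ∑<-* n x a = sym (*-distribˡ-sum {n} x (a ∘ toℕ))

  ∑<-mono-≤ : ∀ n {a b} → (∀ k → a k ≤ b k) → ∑< n a ≤ ∑< n b
  ∑<-mono-≤ zero    a≤b = ≤-refl
  ∑<-mono-≤ (suc n) a≤b = +-mono-≤ (a≤b 0) (∑<-mono-≤ n (λ k → a≤b (suc k)))

  ∑<-nonNeg : ∀ n {a} → (∀ k → 0# ≤ a k) → 0# ≤ ∑< n a
  ∑<-nonNeg zero    0≤a = ≤-refl
  ∑<-nonNeg (suc n) 0≤a = +-nonNeg (0≤a 0) (∑<-nonNeg n (λ k → 0≤a (suc k)))

  ∑<-monoˡ-≤ : ∀ {a m n} → (∀ k → 0# ≤ a k) → m ℕ.≤ n → ∑< m a ≤ ∑< n a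
  ∑<-monoˡ-≤ 0≤a (z≤n {n})   = ∑<-nonNeg n 0≤a
  ∑<-monoˡ-≤ 0≤a (s≤s m≤n) = +-mono-≤ ≤-refl (∑<-monoˡ-≤ (λ k → 0≤a (suc k)) m≤n)

  nonNeg-series-converges : ∀ {a x} → (∀ k → 0# ≤ a k) → (∀ n → ∑< n a ≤ x) →
                            ∃[ l ] ((λ n → ∑< n a) ⟶ l)
  nonNeg-series-converges 0≤a = monotone-converges (λ _ _ → ∑<-monoˡ-≤ 0≤a)

  -- The series is the difference of the series of `a k + α k` and of `α k`. Both have nonnegative
  -- terms and bounded partial sums, so monotone convergence applies to each.
  absolutely-convergent : ∀ {a α x} → (∀ k → ∣ a k ∣≤ α k) → (∀ n → ∑< n α ≤ x) →
                          ∃[ l ] ((λ n → ∑< n a) ⟶ l)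
  absolutely-convergent {a} {α} {x} a≤α α≤x =
    proj₁ sums - proj₁ majorants ,
    ⟶-resp (λ n → trans (+-congʳ (∑<-+ n a α))
                   (solve 2 (λ s t → (s :+ t) :- t := s) refl (∑< n a) (∑< n α)))
           refl (⟶-sub (proj₂ sums) (proj₂ majorants))
    where
    0≤a+α : ∀ k → 0# ≤ a k + α k
    0≤a+α k = ≤-trans (x≤y⇒0≤y-x (proj₁ (a≤α k)))
      (≤-reflexive (solve 2 (λ a b → a :- (:- b) := a :+ b) refl (a k) (α k)))

    sums = nonNeg-series-converges 0≤a+α λ n → begin
      ∑< n (λ k → a k + α k)  ≤⟨ ∑<-mono-≤ n {b = λ k → α k + α k} (λ k → +-mono-≤ (proj₂ (a≤α k)) ≤-refl) ⟩
      ∑< n (λ k → α k + α k)  ≈⟨ ∑<-+ n α α ⟩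
      ∑< n α + ∑< n α         ≤⟨ +-mono-≤ (α≤x n) (α≤x n) ⟩
      x + x                   ∎

    majorants = nonNeg-series-converges (λ k → 0≤∣∣ (a≤α k)) α≤x

  -- The coefficients of the Cauchy product, with `a` shifted at each step so that the index of `b`
  -- needs no subtraction.
  convolution : (ℕ → Carrier) → (ℕ → Carrier) → ℕ → Carrier
  convolution a b zero    = a 0 * b 0
  convolution a b (suc k) = a 0 * b (suc k) + convolution (a ∘ suc) b k

  -- The sum of a i * b j over i + j < n.
  triangle : ℕ → (ℕ → Carrier) → (ℕ → Carrier) → Carrier
  triangle zero    a b = 0#
  triangle (suc n) a b = a 0 * ∑< (suc n) b + triangle n (a ∘ suc) b

  triangle≈∑<-convolution : ∀ n a b → triangle n a b ≈ ∑< n (convolution a b)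
  triangle≈∑<-convolution zero    a b = refl
  triangle≈∑<-convolution (suc n) a b = begin-equality
    a 0 * (b 0 + ∑< n (b ∘ suc)) + triangle n (a ∘ suc) b
      ≈⟨ +-congˡ (triangle≈∑<-convolution n (a ∘ suc) b) ⟩
    a 0 * (b 0 + ∑< n (b ∘ suc)) + ∑< n (convolution (a ∘ suc) b)
      ≈⟨ solve 4 (λ a b s t → a :* (b :+ s) :+ t := a :* b :+ (a :* s :+ t)) refl _ _ _ _ ⟩
    a 0 * b 0 + (a 0 * ∑< n (b ∘ suc) + ∑< n (convolution (a ∘ suc) b))
      ≈⟨ +-congˡ (+-congʳ (∑<-* n (a 0) (b ∘ suc))) ⟨
    a 0 * b 0 + (∑< n (λ k → a 0 * b (suc k)) + ∑< n (convolution (a ∘ suc) b))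
      ≈⟨ +-congˡ (∑<-+ n (λ k → a 0 * b (suc k)) (convolution (a ∘ suc) b)) ⟨
    ∑< (suc n) (convolution a b) ∎

  -- Row by row, no row of the triangle is longer than `m`. The width `m` is separate from `n`
  -- because the induction removes a row and leaves the columns alone.
  triangle≤square : ∀ n {a b} → (∀ k → 0# ≤ a k) → (∀ k → 0# ≤ b k) → ∀ {m} → n ℕ.≤ m →
                    triangle n a b ≤ ∑< n a * ∑< m b
  triangle≤square zero    0≤a 0≤b {m} _ = ≤-reflexive (sym (zeroˡ _))
  triangle≤square (suc n) {a} {b} 0≤a 0≤b {m} n<m = begin
    a 0 * ∑< (suc n) b + triangle n (a ∘ suc) b
      ≤⟨ +-mono-≤ (*-monoʳ-≤ (0≤a 0) (∑<-monoˡ-≤ 0≤b n<m))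
                  (triangle≤square n (0≤a ∘ suc) 0≤b (ℕ.<⇒≤ n<m)) ⟩
    a 0 * ∑< m b + ∑< n (a ∘ suc) * ∑< m b
      ≈⟨ distribʳ (∑< m b) (a 0) (∑< n (a ∘ suc)) ⟨
    ∑< (suc n) a * ∑< m b ∎

  -- From `i < m` and `j < n` follows `i + j < m + n`, so the rectangle lies inside the larger
  -- triangle.
  square≤triangle : ∀ m n {a b} → (∀ k → 0# ≤ a k) → (∀ k → 0# ≤ b k) →
                    ∑< m a * ∑< n b ≤ triangle (m ℕ.+ n) a b
  square≤triangle zero n {a} {b} 0≤a 0≤b = ≤-trans (≤-reflexive (zeroˡ _)) (triangle-nonNeg n 0≤a)
    where
    triangle-nonNeg : ∀ n {a} → (∀ k → 0# ≤ a k) → 0# ≤ triangle n a b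
    triangle-nonNeg zero    0≤a = ≤-refl
    triangle-nonNeg (suc n) 0≤a =
      +-nonNeg (*-nonNeg (0≤a 0) (∑<-nonNeg (suc n) 0≤b)) (triangle-nonNeg n (0≤a ∘ suc))
  square≤triangle (suc m) n {a} {b} 0≤a 0≤b = begin
    ∑< (suc m) a * ∑< n b
      ≈⟨ distribʳ (∑< n b) (a 0) (∑< m (a ∘ suc)) ⟩
    a 0 * ∑< n b + ∑< m (a ∘ suc) * ∑< n b
      ≤⟨ +-mono-≤ (*-monoʳ-≤ (0≤a 0) (∑<-monoˡ-≤ 0≤b (ℕ.m≤n+m n (suc m))))
                  (square≤triangle m n (0≤a ∘ suc) 0≤b) ⟩
    triangle (suc m ℕ.+ n) a b ∎

  ∑<-tail-bound : ∀ {a α m n} → (∀ k → ∣ a k ∣≤ α k) → m ℕ.≤ n →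
                  ∣ ∑< n a - ∑< m a ∣≤ (∑< n α - ∑< m α)
  ∑<-tail-bound {n = zero}  a≤α z≤n = ∣∣-weaken (∣∣-cong (sym (-‿inverseʳ 0#)) (nonNeg-∣∣ ≤-refl))
                                       (≤-reflexive (sym (-‿inverseʳ 0#)))
  ∑<-tail-bound {a} {α} {n = suc n} a≤α z≤n = ∣∣-weaken
    (∣∣-cong (solve 2 (λ x y → x :+ (y :- :0) := (x :+ y) :- :0) refl (a 0) (∑< n (a ∘ suc)))
      (∣∣-+ (a≤α 0) (∑<-tail-bound {m = 0} {n} (a≤α ∘ suc) z≤n)))
    (≤-reflexive (solve 2 (λ x y → x :+ (y :- :0) := (x :+ y) :- :0) refl (α 0) (∑< n (α ∘ suc))))
  ∑<-tail-bound {a} {α} {suc m} {suc n} a≤α (s≤s m≤n) = ∣∣-weaken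
    (∣∣-cong (shift (a 0) (∑< n (a ∘ suc)) (∑< m (a ∘ suc))) (∑<-tail-bound (a≤α ∘ suc) m≤n))
    (≤-reflexive (shift (α 0) (∑< n (α ∘ suc)) (∑< m (α ∘ suc))))
    where
    shift : ∀ x y z → y - z ≈ (x + y) - (x + z)
    shift = solve 3 (λ x y z → y :- z := (x :+ y) :- (x :+ z)) refl

  -- Both differences run over the cells with `i < n`, `j < m` and `n ≤ i + j`. Row `i` contributes
  -- `a i` times a tail of `b`, dominated by `α i` times the same tail of `β`.
  square-triangle-bound : ∀ n {a b α β} → (∀ k → ∣ a k ∣≤ α k) → (∀ k → ∣ b k ∣≤ β k) → ∀ {m} → n ℕ.≤ m →
    ∣ ∑< n a * ∑< m b - triangle n a b ∣≤ (∑< n α * ∑< m β - triangle n α β)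
  square-triangle-bound zero a≤α b≤β {m} _ =
    ∣∣-weaken (∣∣-cong (vanish _) (nonNeg-∣∣ ≤-refl)) (≤-reflexive (vanish _))
    where
    vanish : ∀ y → 0# ≈ 0# * y - 0#
    vanish = solve 1 (λ y → :0 := :0 :* y :- :0) refl
  square-triangle-bound (suc n) {a} {b} {α} {β} a≤α b≤β {m} n<m = ∣∣-weaken
    (∣∣-cong (sym (split (a 0) (∑< n (a ∘ suc)) (∑< m b) (∑< (suc n) b) (triangle n (a ∘ suc) b)))
      (∣∣-+ (∣∣-* (a≤α 0) (∑<-tail-bound b≤β n<m)) (square-triangle-bound n (a≤α ∘ suc) b≤β (ℕ.<⇒≤ n<m))))
    (≤-reflexive (sym (split (α 0) (∑< n (α ∘ suc)) (∑< m β) (∑< (suc n) β) (triangle n (α ∘ suc) β))))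
    where
    split : ∀ x y z w t → (x + y) * z - (x * w + t) ≈ x * (z - w) + (y * z - t)
    split = solve 5 (λ x y z w t → (x :+ y) :* z :- (x :* w :+ t) := x :* (z :- w) :+ (y :* z :- t)) refl

  convolution-cong : ∀ {a a′ b b′} → (∀ k → a k ≈ a′ k) → (∀ k → b k ≈ b′ k) → ∀ k →
                     convolution a b k ≈ convolution a′ b′ k
  convolution-cong a≈a′ b≈b′ zero    = *-cong (a≈a′ 0) (b≈b′ 0)
  convolution-cong a≈a′ b≈b′ (suc k) =
    +-cong (*-cong (a≈a′ 0) (b≈b′ (suc k))) (convolution-cong (a≈a′ ∘ suc) b≈b′ k)

  convolution-+ˡ : ∀ a a′ b k → convolution (λ j → a j + a′ j) b k ≈ convolution a b k + convolution a′ b k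
  convolution-+ˡ a a′ b zero    = distribʳ (b 0) (a 0) (a′ 0)
  convolution-+ˡ a a′ b (suc k) = trans (+-congˡ (convolution-+ˡ (a ∘ suc) (a′ ∘ suc) b k))
    (solve 5 (λ a a′ b s t → (a :+ a′) :* b :+ (s :+ t) := (a :* b :+ s) :+ (a′ :* b :+ t)) refl _ _ _ _ _)

  convolution-*ˡ : ∀ x a b k → convolution (λ j → x * a j) b k ≈ x * convolution a b k
  convolution-*ˡ x a b zero    = *-assoc x (a 0) (b 0)
  convolution-*ˡ x a b (suc k) = trans (+-congˡ (convolution-*ˡ x (a ∘ suc) b k))
    (solve 4 (λ x a b s → x :* a :* b :+ x :* s := x :* (a :* b :+ s)) refl _ _ _ _)

  convolution-*ʳ : ∀ x a b k → convolution a (λ j → x * b j) k ≈ x * convolution a b k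
  convolution-*ʳ x a b zero    = solve 3 (λ x a b → a :* (x :* b) := x :* (a :* b)) refl _ _ _
  convolution-*ʳ x a b (suc k) = trans (+-congˡ (convolution-*ʳ x (a ∘ suc) b k))
    (solve 4 (λ x a b s → a :* (x :* b) :+ x :* s := x :* (a :* b :+ s)) refl _ _ _ _)

  -- The coefficients of the derivative of the power series with coefficients a.
  derivative : (ℕ → Carrier) → ℕ → Carrier
  derivative a k = fromℕ (suc k) * a (suc k)

  -- The Leibniz rule for formal power series. In the induction the weight is `1# + n`: the `n`
  -- copies form the derivative for the shifted `a`, and the extra copy is absorbed by `shift`,
  -- since shifting and differentiating do not commute.
  convolution-derivative : ∀ a b k →
    derivative (convolution a b) k ≈ convolution (derivative a) b k + convolution a (derivative b) k
  convolution-derivative a b zero =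
    solve 5 (λ n a₀ a₁ b₀ b₁ → n :* (a₀ :* b₁ :+ a₁ :* b₀) := n :* a₁ :* b₀ :+ a₀ :* (n :* b₁)) refl
      (fromℕ 1) (a 0) (a 1) (b 0) (b 1)
  convolution-derivative a b (suc k) = begin-equality
    (1# + n) * (a 0 * b (suc (suc k)) + (a 1 * b (suc k) + r))
      ≈⟨ solve 6 (λ n a₀ b₂ a₁ b₁ r →
           (:1 :+ n) :* (a₀ :* b₂ :+ (a₁ :* b₁ :+ r)) :=
           -- Here `:1 :+ :0` is the unfolded `fromℕ 1` of `derivative a 0`.
           ((:1 :+ :0) :* a₁ :* b₁ :+ r) :+ a₀ :* ((:1 :+ n) :* b₂) :+ n :* (a₁ :* b₁ :+ r)) refl
           n (a 0) (b (suc (suc k))) (a 1) (b (suc k)) r ⟩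
    (derivative a 0 * b (suc k) + r) + a 0 * derivative b (suc k) + derivative (convolution (a ∘ suc) b) k
      ≈⟨ +-congˡ (convolution-derivative (a ∘ suc) b k) ⟩
    (derivative a 0 * b (suc k) + r) + a 0 * derivative b (suc k) + (p + q)
      ≈⟨ solve 5 (λ x r y p q → (x :+ r) :+ y :+ (p :+ q) := (x :+ (p :+ r)) :+ (y :+ q)) refl
           (derivative a 0 * b (suc k)) r (a 0 * derivative b (suc k)) p q ⟩
    (derivative a 0 * b (suc k) + (p + r)) + (a 0 * derivative b (suc k) + q)
      ≈⟨ +-congʳ (+-congˡ (trans (convolution-cong shift (λ _ → refl) k)
           (convolution-+ˡ (derivative (a ∘ suc)) (λ j → a (suc (suc j))) b k))) ⟨
    convolution (derivative a) b (suc k) + convolution a (derivative b) (suc k) ∎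
    where
    n = fromℕ (suc k)
    p = convolution (derivative (a ∘ suc)) b k
    q = convolution (a ∘ suc) (derivative b) k
    r = convolution (λ j → a (suc (suc j))) b k

    shift : ∀ j → derivative a (suc j) ≈ derivative (a ∘ suc) j + a (suc (suc j))
    shift j = solve 2 (λ n x → (:1 :+ n) :* x := n :* x :+ x) refl (fromℕ (suc j)) (a (suc (suc j)))

-- The exponential function, its functional equation and its inverse.

module Exponential (em : ExcludedMiddle 0ℓ) (ℝ : CompleteOrderedField) where
  open OrderedField em ℝ
  open Limits em ℝ
  open Series em ℝ
  open Analysis em ℝ
  open Exp semiring using (^-congˡ)
  open Mult semiring using (×1-homo-*)

  term : Carrier → ℕ → Carrier
  term x k = x ^ k / fromℕ (k !)

  0<k! : ∀ k → 0# < fromℕ (k !)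
  0<k! zero    = 0<fromℕ-suc 0
  0<k! (suc k) = begin-strict
    0#                            <⟨ *-pos (0<fromℕ-suc k) (0<k! k) ⟩
    fromℕ (suc k) * fromℕ (k !)   ≈⟨ ×1-homo-* (suc k) (k !) ⟨
    fromℕ (suc k !)               ∎

  term-zero : ∀ x → term x 0 ≈ 1#
  term-zero x = begin-equality
    1# / fromℕ 1              ≈⟨ *-identityˡ _ ⟨
    1# * (1# / fromℕ 1)       ≈⟨ *-congʳ (+-identityʳ 1#) ⟨
    fromℕ 1 * (1# / fromℕ 1)  ≈⟨ y*[x/y]≈x 1# (0<fromℕ-suc 0) ⟩
    1#                        ∎

  -- The sequence `term x` gives the coefficients of `exp (x t)` as a series in `t`, and
  -- differentiating that in `t` multiplies it by `x`.
  term-derivative : ∀ x k → derivative (term x) k ≈ x * term x k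
  term-derivative x k = *-cancelˡ (0<k! k) (begin-equality
    f * (s * (x ^ suc k / f′))        ≈⟨ solve 3 (λ f s t → f :* (s :* t) := (s :* f) :* t) refl f s _ ⟩
    s * f * (x ^ suc k / f′)          ≈⟨ *-congʳ (×1-homo-* (suc k) (k !)) ⟨
    f′ * (x ^ suc k / f′)             ≈⟨ y*[x/y]≈x (x ^ suc k) (0<k! (suc k)) ⟩
    x * x ^ k                         ≈⟨ *-congˡ (y*[x/y]≈x (x ^ k) (0<k! k)) ⟨
    x * (f * term x k)                ≈⟨ solve 3 (λ x f t → x :* (f :* t) := f :* (x :* t)) refl x f (term x k) ⟩
    f * (x * term x k)                ∎)
    where
    s  = fromℕ (suc k)
    f  = fromℕ (k !)
    f′ = fromℕ (suc k !)

  term-cong : ∀ {x y} → x ≈ y → ∀ k → term x k ≈ term y k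
  term-cong x≈y k = *-congʳ (^-congˡ k x≈y)

  term-bound : ∀ {x y} → ∣ x ∣≤ y → ∀ k → ∣ term x k ∣≤ term y k
  term-bound {x} {y} x≤y k = ∣∣-* (power k) (nonNeg-∣∣ (<⇒≤ (0<x⁻¹ (0<k! k))))
    where
    power : ∀ k → ∣ x ^ k ∣≤ y ^ k
    power zero    = nonNeg-∣∣ 0≤1
    power (suc k) = ∣∣-* x≤y (power k)

  term-nonNeg : ∀ {x} → 0# ≤ x → ∀ k → 0# ≤ term x k
  term-nonNeg 0≤x k = 0≤∣∣ (term-bound (nonNeg-∣∣ 0≤x) k)

  -- The binomial theorem divided by the factorial. By the Leibniz rule both sequences satisfy
  -- `(k + 1) c (k + 1) = (x + y) c k` with `c 0 = 1`, which determines them because `fromℕ (suc k)`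
  -- is positive.
  convolution-term : ∀ x y k → convolution (term x) (term y) k ≈ term (x + y) k
  convolution-term x y zero = begin-equality
    term x 0 * term y 0  ≈⟨ *-cong (term-zero x) (term-zero y) ⟩
    1# * 1#              ≈⟨ *-identityʳ 1# ⟩
    1#                   ≈⟨ term-zero (x + y) ⟨
    term (x + y) 0       ∎
  convolution-term x y (suc k) = *-cancelˡ (0<fromℕ-suc k) (begin-equality
    derivative (convolution (term x) (term y)) k
      ≈⟨ convolution-derivative (term x) (term y) k ⟩
    convolution (derivative (term x)) (term y) k + convolution (term x) (derivative (term y)) k
      ≈⟨ +-cong (trans (convolution-cong (term-derivative x) (λ _ → refl) k) (convolution-*ˡ x (term x) (term y) k))
                (trans (convolution-cong (λ _ → refl) (term-derivative y) k) (convolution-*ʳ y (term x) (term y) k)) ⟩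
    x * convolution (term x) (term y) k + y * convolution (term x) (term y) k
      ≈⟨ distribʳ _ x y ⟨
    (x + y) * convolution (term x) (term y) k
      ≈⟨ *-congˡ (convolution-term x y k) ⟩
    (x + y) * term (x + y) k
      ≈⟨ term-derivative (x + y) k ⟨
    derivative (term (x + y)) k ∎)

  expₙ : ℕ → Carrier → Carrier
  expₙ n x = ∑< n (term x)

  expₙ-cong : ∀ {x y} → x ≈ y → ∀ n → expₙ n x ≈ expₙ n y
  expₙ-cong {x} {y} x≈y n = ∑<-cong n {term x} {term y} (term-cong x≈y)

  triangle-term : ∀ n x y → triangle n (term x) (term y) ≈ expₙ n (x + y)
  triangle-term n x y = trans (triangle≈∑<-convolution n (term x) (term y)) (∑<-cong n (convolution-term x y))

  -- Comparison with the geometric series: each term is at most `x` times the one before, so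
  -- `expₙ n x ≤ 1# + x * expₙ n x`.
  expₙ*[1-x]≤1 : ∀ {x} → 0# ≤ x → ∀ n → expₙ n x * (1# - x) ≤ 1#
  expₙ*[1-x]≤1 {x} 0≤x n = ≤-by _ (x≤y⇒0≤y-x expₙ≤1+x*expₙ)
    (solve 2 (λ x e → :1 :- e :* (:1 :- x) := (:1 :+ x :* e) :- e) refl x (expₙ n x))
    where
    shrink : ∀ k → term x (suc k) ≤ x * term x k
    shrink k = ≤-by (fromℕ k * term x (suc k)) (*-nonNeg (0≤fromℕ k) (term-nonNeg 0≤x (suc k)))
      (trans (+-congʳ (sym (term-derivative x k)))
        (solve 2 (λ n t → (:1 :+ n) :* t :- t := n :* t) refl (fromℕ k) (term x (suc k))))

    expₙ≤1+x*expₙ : expₙ n x ≤ 1# + x * expₙ n x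
    expₙ≤1+x*expₙ = begin
      expₙ n x                            ≤⟨ ∑<-monoˡ-≤ (term-nonNeg 0≤x) (ℕ.n≤1+n n) ⟩
      term x 0 + ∑< n (term x ∘ suc)      ≤⟨ +-mono-≤ (≤-reflexive (term-zero x)) (∑<-mono-≤ n shrink) ⟩
      1# + ∑< n (λ k → x * term x k)      ≈⟨ +-congˡ (∑<-* n x (term x)) ⟩
      1# + x * expₙ n x                   ∎

  ExpBounded : Carrier → Set
  ExpBounded x = ∃[ y ] (∀ n → expₙ n x ≤ y)

  -- The partial sum at `x + y` is a triangle inside the square of the two partial sums, so bounds
  -- multiply. This carries boundedness from one half to `1#` and then to every natural number.
  expBounded-+ : ∀ {x y} → 0# ≤ x → 0# ≤ y → ExpBounded x → ExpBounded y → ExpBounded (x + y)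
  expBounded-+ {x} {y} 0≤x 0≤y (b , ≤b) (c , ≤c) = b * c , λ n → begin
    expₙ n (x + y)                    ≈⟨ triangle-term n x y ⟨
    triangle n (term x) (term y)      ≤⟨ triangle≤square n (term-nonNeg 0≤x) (term-nonNeg 0≤y) ℕ.≤-refl ⟩
    expₙ n x * expₙ n y               ≤⟨ *-monoʳ-≤ (∑<-nonNeg n (term-nonNeg 0≤x)) (≤c n) ⟩
    -- The empty sum `expₙ 0 y` is zero, so `≤c 0` says `0# ≤ c`.
    expₙ n x * c                      ≤⟨ *-monoˡ-≤ (≤c 0) (≤b n) ⟩
    b * c                             ∎

  expBounded-cong : ∀ {x y} → x ≈ y → ExpBounded x → ExpBounded y
  expBounded-cong x≈y (b , ≤b) = b , λ n → ≤-trans (≤-reflexive (expₙ-cong (sym x≈y) n)) (≤b n)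

  expBounded-½ : ∀ {h} → 0# ≤ h → h + h ≈ 1# → ExpBounded h
  expBounded-½ {h} 0≤h h+h≈1 = 1# + 1# , λ n → e≤2 (expₙ n h) (expₙ*[1-x]≤1 0≤h n)
    where
    1-h≈h : 1# - h ≈ h
    1-h≈h = begin-equality
      1# - h        ≈⟨ +-congʳ h+h≈1 ⟨
      (h + h) - h   ≈⟨ solve 1 (λ h → (h :+ h) :- h := h) refl h ⟩
      h             ∎

    e≤2 : ∀ e → e * (1# - h) ≤ 1# → e ≤ 1# + 1#
    e≤2 e e*[1-h]≤1 = begin
      e              ≈⟨ *-identityʳ e ⟨
      e * 1#         ≈⟨ *-congˡ h+h≈1 ⟨
      e * (h + h)    ≈⟨ distribˡ e h h ⟩
      e * h + e * h  ≤⟨ +-mono-≤ e*h≤1 e*h≤1 ⟩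
      1# + 1#        ∎
      where
      e*h≤1 : e * h ≤ 1#
      e*h≤1 = ≤-trans (≤-reflexive (*-congˡ (sym 1-h≈h))) e*[1-h]≤1

  expBounded-1 : ExpBounded 1#
  expBounded-1 = expBounded-cong (half+half 1#) (expBounded-+ 0≤½ 0≤½ ½-bounded ½-bounded)
    where
    0≤½ : 0# ≤ half 1#
    0≤½ = <⇒≤ (half-pos 0<1)

    ½-bounded : ExpBounded (half 1#)
    ½-bounded = expBounded-½ 0≤½ (half+half 1#)

  expBounded-0 : ExpBounded 0#
  expBounded-0 = 1# , λ n → begin
    expₙ n 0#                 ≈⟨ solve 1 (λ e → e := e :* (:1 :- :0)) refl (expₙ n 0#) ⟩
    expₙ n 0# * (1# - 0#)     ≤⟨ expₙ*[1-x]≤1 ≤-refl n ⟩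
    1#                        ∎

  expBounded-fromℕ : ∀ n → ExpBounded (fromℕ n)
  expBounded-fromℕ zero    = expBounded-0
  expBounded-fromℕ (suc m) = expBounded-+ 0≤1 (0≤fromℕ m) expBounded-1 (expBounded-fromℕ m)

  -- Some natural number `m` bounds the absolute value of `x`, and the series at `m` is a convergent
  -- majorant.
  expₙ⟶exp : ∀ x → (λ n → expₙ n x) ⟶ exp x
  expₙ⟶exp x with y , 0<y , ∣x∣≤y ← ∣∣-bound x with m , y<m ← archimedean y =
    lim-limit (proj₂ (absolutely-convergent (term-bound (∣∣-weaken ∣x∣≤y (<⇒≤ y<m))) (proj₂ (expBounded-fromℕ m))))

  exp-cong : ∀ {x y} → x ≈ y → exp x ≈ exp y
  exp-cong {x} {y} x≈y =
    ⟶-unique (⟶-resp (expₙ-cong x≈y) refl (expₙ⟶exp x)) (expₙ⟶exp y)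

  expₙ≤exp : ∀ {x} → 0# ≤ x → ∀ n → expₙ n x ≤ exp x
  expₙ≤exp {x} 0≤x n = ⟶-≥ n (expₙ⟶exp x) (λ _ → ∑<-monoˡ-≤ (term-nonNeg 0≤x))

  -- The difference expₙ n x * expₙ n y - expₙ n (x + y) is dominated by its value
  -- at upper bounds X and Y of ∣x∣ and ∣y∣, which is at most exp (X + Y) - expₙ n (X + Y).
  exp-+ : ∀ x y → exp (x + y) ≈ exp x * exp y
  exp-+ x y with X , 0<X , ∣x∣≤X ← ∣∣-bound x | Y , 0<Y , ∣y∣≤Y ← ∣∣-bound y =
    ⟶-unique (expₙ⟶exp (x + y)) (⟶-resp
      (λ n → solve 2 (λ p e → p :- (p :- e) := e) refl (expₙ n x * expₙ n y) (expₙ n (x + y)))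
      (solve 1 (λ p → p :- :0 := p) refl (exp x * exp y))
      (⟶-sub (⟶-* (expₙ⟶exp x) (expₙ⟶exp y)) (Null⇒⟶
        (Null-resp (λ n → solve 1 (λ d → d := d :- :0) refl (expₙ n x * expₙ n y - expₙ n (x + y)))
          (Null-squeeze bound (Null-resp
            (λ n → solve 2 (λ e l → :- (e :- l) := l :- e) refl (expₙ n (X + Y)) (exp (X + Y)))
            (Null-neg (⟶⇒Null (expₙ⟶exp (X + Y))))))))))
    where
    0≤X = <⇒≤ 0<X
    0≤Y = <⇒≤ 0<Y

    bound : ∀ n → ∣ expₙ n x * expₙ n y - expₙ n (x + y) ∣≤ (exp (X + Y) - expₙ n (X + Y))
    bound n = ∣∣-weaken
      (∣∣-cong (+-congˡ (-‿cong (triangle-term n x y)))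
        (square-triangle-bound n (term-bound ∣x∣≤X) (term-bound ∣y∣≤Y) ℕ.≤-refl))
      (+-mono-≤
        (begin
          expₙ n X * expₙ n Y                    ≤⟨ square≤triangle n n (term-nonNeg 0≤X) (term-nonNeg 0≤Y) ⟩
          triangle (n ℕ.+ n) (term X) (term Y)   ≈⟨ triangle-term (n ℕ.+ n) X Y ⟩
          expₙ (n ℕ.+ n) (X + Y)                 ≤⟨ expₙ≤exp (+-nonNeg 0≤X 0≤Y) (n ℕ.+ n) ⟩
          exp (X + Y)                            ∎)
        (≤-reflexive (-‿cong (triangle-term n X Y))))

  1+x≤exp : ∀ {x} → 0# ≤ x → 1# + x ≤ exp x
  1+x≤exp {x} 0≤x = begin
    1# + x      ≈⟨ +-cong (sym (term-zero x)) (sym (begin-equality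
                    term x 1 + 0#             ≈⟨ solve 1 (λ t → t :+ :0 := (:1 :+ :0) :* t) refl (term x 1) ⟩
                    derivative (term x) 0     ≈⟨ term-derivative x 0 ⟩
                    x * term x 0              ≈⟨ *-congˡ (term-zero x) ⟩
                    x * 1#                    ≈⟨ *-identityʳ x ⟩
                    x                         ∎)) ⟩
    expₙ 2 x    ≤⟨ expₙ≤exp 0≤x 2 ⟩
    exp x       ∎

  exp*[1-x]≤1 : ∀ {x} → 0# ≤ x → exp x * (1# - x) ≤ 1#
  exp*[1-x]≤1 {x} 0≤x =
    ⟶-≤ (⟶-* (expₙ⟶exp x) (⟶-eventually 0 (λ _ _ → refl))) (expₙ*[1-x]≤1 0≤x)

  exp-0 : exp 0# ≈ 1#
  exp-0 = antisym
    (≤-trans (≤-reflexive (solve 1 (λ e → e := e :* (:1 :- :0)) refl (exp 0#))) (exp*[1-x]≤1 ≤-refl))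
    (≤-trans (≤-reflexive (sym (+-identityʳ 1#))) (1+x≤exp ≤-refl))

  exp*exp-neg : ∀ x → exp x * exp (- x) ≈ 1#
  exp*exp-neg x = trans (sym (exp-+ x (- x))) (trans (exp-cong (-‿inverseʳ x)) exp-0)

  exp-pos : ∀ x → 0# < exp x
  exp-pos x with total 0# x
  ... | inj₁ 0≤x = begin-strict
    0#      <⟨ 0<1+x 0≤x ⟩
    1# + x  ≤⟨ 1+x≤exp 0≤x ⟩
    exp x   ∎
  ... | inj₂ x≤0 = begin-strict
    0#              <⟨ 0<x⁻¹ 0<exp-neg ⟩
    exp (- x) ⁻¹    ≈⟨ ⁻¹-unique 0<exp-neg (trans (*-comm _ _) (exp*exp-neg x)) ⟨
    exp x           ∎
    where
    0≤-x : 0# ≤ - x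
    0≤-x = ≤-trans (≤-reflexive (sym -0#≈0#)) (-‿mono-≤ x≤0)

    0<exp-neg : 0# < exp (- x)
    0<exp-neg = begin-strict
      0#         <⟨ 0<1+x 0≤-x ⟩
      1# - x     ≤⟨ 1+x≤exp 0≤-x ⟩
      exp (- x)  ∎

  exp-mono-≤ : ∀ {x y} → x ≤ y → exp x ≤ exp y
  exp-mono-≤ {x} {y} x≤y = begin
    exp x                  ≈⟨ *-identityʳ _ ⟨
    exp x * 1#             ≤⟨ *-monoʳ-≤ (<⇒≤ (exp-pos x)) (begin
      1#                     ≤⟨ ≤-by _ 0≤y-x (solve 1 (λ d → (:1 :+ d) :- :1 := d) refl (y - x)) ⟩
      1# + (y - x)           ≤⟨ 1+x≤exp 0≤y-x ⟩
      exp (y - x)            ∎) ⟩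
    exp x * exp (y - x)    ≈⟨ exp-+ x (y - x) ⟨
    exp (x + (y - x))      ≈⟨ exp-cong (solve 2 (λ x y → x :+ (y :- x) := y) refl x y) ⟩
    exp y                  ∎
    where
    0≤y-x = x≤y⇒0≤y-x x≤y

  exp-cancel-≤ : ∀ {x y} → exp x ≤ exp y → x ≤ y
  exp-cancel-≤ {x} {y} expx≤expy = ≮⇒≥ λ y<x →
    ≤⇒≯ (*-cancelˡ-≤ (exp-pos y) (begin
      exp y * (1# + (x - y))   ≤⟨ *-monoʳ-≤ (<⇒≤ (exp-pos y)) (1+x≤exp (<⇒≤ (x<y⇒0<y-x y<x))) ⟩
      exp y * exp (x - y)      ≈⟨ exp-+ y (x - y) ⟨
      exp (y + (x - y))        ≈⟨ exp-cong (solve 2 (λ x y → y :+ (x :- y) := x) refl x y) ⟩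
      exp x                    ≤⟨ expx≤expy ⟩
      exp y                    ≈⟨ *-identityʳ _ ⟨
      exp y * 1#               ∎))
      (<-by (x - y) (x<y⇒0<y-x y<x) (solve 1 (λ d → (:1 :+ d) :- :1 := d) refl (x - y)))

  exp-injective : ∀ {x y} → exp x ≈ exp y → x ≈ y
  exp-injective eq = antisym (exp-cancel-≤ (≤-reflexive eq)) (exp-cancel-≤ (≤-reflexive (sym eq)))

  1-x≤exp-neg : ∀ {x} → 0# ≤ x → 1# - x ≤ exp (- x)
  1-x≤exp-neg {x} 0≤x = *-cancelˡ-≤ (exp-pos x)
    (≤-trans (exp*[1-x]≤1 0≤x) (≤-reflexive (sym (exp*exp-neg x))))

  exp-surjective : ∀ {y} → 0# < y → ∃[ x ] (exp x ≈ y)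
  exp-surjective {y} 0<y = s , antisym (≮⇒≥ ≯y) (≮⇒≥ ≮y)
    where
    A : Carrier → Set
    A x = exp x ≤ y

    -- The witness comes from `y ⁻¹ ≤ 1# + y ⁻¹ ≤ exp (y ⁻¹)` by taking reciprocals.
    nonempty : exp (- (y ⁻¹)) ≤ y
    nonempty = *-cancelˡ-≤ (exp-pos (y ⁻¹)) (begin
      exp (y ⁻¹) * exp (- (y ⁻¹))  ≈⟨ exp*exp-neg (y ⁻¹) ⟩
      1#                           ≈⟨ x*x⁻¹≈1 0<y ⟨
      y * y ⁻¹                     ≤⟨ *-monoʳ-≤ (<⇒≤ 0<y) (≤-by 1# 0≤1
                                        (solve 1 (λ z → (:1 :+ z) :- z := :1) refl (y ⁻¹))) ⟩
      y * (1# + y ⁻¹)              ≤⟨ *-monoʳ-≤ (<⇒≤ 0<y) (1+x≤exp (<⇒≤ (0<x⁻¹ 0<y))) ⟩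
      y * exp (y ⁻¹)               ≈⟨ *-comm _ _ ⟩
      exp (y ⁻¹) * y               ∎)

    bounded : IsUpperBound A y
    bounded x expx≤y = exp-cancel-≤ (begin
      exp x   ≤⟨ expx≤y ⟩
      y       ≤⟨ ≤-by 1# 0≤1 (solve 1 (λ y → (:1 :+ y) :- y := :1) refl y) ⟩
      1# + y  ≤⟨ 1+x≤exp (<⇒≤ 0<y) ⟩
      exp y   ∎)

    sup = complete A (- (y ⁻¹) , nonempty) (y , bounded)

    s     = proj₁ sup
    upper = proj₁ (proj₂ sup)
    least = proj₂ (proj₂ sup)

    0<1-u/v : ∀ {u v} → 0# < v → u < v → 0# < 1# - u / v
    0<1-u/v {u} {v} 0<v u<v = begin-strict
      0#                      <⟨ *-pos (x<y⇒0<y-x u<v) (0<x⁻¹ 0<v) ⟩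
      (v - u) * v ⁻¹          ≈⟨ solve 3 (λ u v w → (v :- u) :* w := v :* w :- u :* w) refl u v (v ⁻¹) ⟩
      v * v ⁻¹ - u * v ⁻¹     ≈⟨ +-congʳ (x*x⁻¹≈1 0<v) ⟩
      1# - u / v              ∎

    -- The relative gap `h = 1# - u / v` is a step that does not overshoot. If `exp s < y`, then
    -- `s + h` still lies in `A`; if `y < exp s`, then `s - h` is still an upper bound.
    u≤v*exp[-[1-u/v]] : ∀ {u v} → 0# < v → u < v → u ≤ v * exp (- (1# - u / v))
    u≤v*exp[-[1-u/v]] {u} {v} 0<v u<v = begin
      u                             ≈⟨ y*[x/y]≈x u 0<v ⟨
      v * (u / v)                   ≈⟨ solve 2 (λ v w → v :* w := v :* (:1 :- (:1 :- w))) refl v (u / v) ⟩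
      v * (1# - (1# - u / v))       ≤⟨ *-monoʳ-≤ (<⇒≤ 0<v) (1-x≤exp-neg (<⇒≤ (0<1-u/v 0<v u<v))) ⟩
      v * exp (- (1# - u / v))      ∎

    ≮y : ¬ (exp s < y)
    ≮y exps<y = ≤⇒≯ (upper (s + h) (begin
      exp (s + h)               ≈⟨ exp-+ s h ⟩
      exp s * exp h             ≤⟨ *-monoˡ-≤ (<⇒≤ (exp-pos h)) (u≤v*exp[-[1-u/v]] 0<y exps<y) ⟩
      y * exp (- h) * exp h     ≈⟨ solve 3 (λ y e f → y :* f :* e := y :* (e :* f)) refl y (exp h) (exp (- h)) ⟩
      y * (exp h * exp (- h))   ≈⟨ *-congˡ (exp*exp-neg h) ⟩
      y * 1#                    ≈⟨ *-identityʳ y ⟩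
      y                         ∎))
      (<-by h (0<1-u/v 0<y exps<y) (solve 2 (λ s h → (s :+ h) :- s := h) refl s h))
      where
      h = 1# - exp s / y

    ≯y : ¬ (y < exp s)
    ≯y y<exps = ≤⇒≯ (least (s - h) (λ x expx≤y → exp-cancel-≤ (begin
      exp x              ≤⟨ expx≤y ⟩
      y                  ≤⟨ u≤v*exp[-[1-u/v]] (exp-pos s) y<exps ⟩
      exp s * exp (- h)  ≈⟨ exp-+ s (- h) ⟨
      exp (s - h)        ∎)))
      (<-by h (0<1-u/v (exp-pos s) y<exps) (solve 2 (λ s h → s :- (s :- h) := h) refl s h))
      where
      h = 1# - y / exp s

  exp-ln : ∀ {x} → 0# < x → exp (ln x) ≈ x
  exp-ln {x} 0<x with em {∃[ y ] (exp y ≈ x)}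
  ... | yes (_ , exp≈x) = exp≈x
  ... | no  none        = ⊥-elim (none (exp-surjective 0<x))

  exp-^ : ∀ x n → exp (x * fromℕ n) ≈ exp x ^ n
  exp-^ x zero    = trans (exp-cong (zeroʳ x)) exp-0
  exp-^ x (suc n) = begin-equality
    exp (x * (1# + fromℕ n))      ≈⟨ exp-cong (solve 2 (λ x n → x :* (:1 :+ n) := x :+ x :* n) refl x (fromℕ n)) ⟩
    exp (x + x * fromℕ n)         ≈⟨ exp-+ x (x * fromℕ n) ⟩
    exp x * exp (x * fromℕ n)     ≈⟨ *-congˡ (exp-^ x n) ⟩
    exp x * exp x ^ n             ∎

-- Density of the rationals.

module Density (em : ExcludedMiddle 0ℓ) (ℝ : CompleteOrderedField) where
  open OrderedField em ℝ

  *-cancelˡ-< : ∀ {x y z} → 0# < x → x * y < x * z → y < z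
  *-cancelˡ-< {x} {y} {z} 0<x xy<xz with ≤-<-connex z y
  ... | inj₁ z≤y = ⊥-elim (≤⇒≯ (*-monoʳ-≤ (<⇒≤ 0<x) z≤y) xy<xz)
  ... | inj₂ y<z = y<z

  floor : ∀ {x} n → 0# ≤ x → x < fromℕ n → ∃[ k ] (fromℕ k ≤ x × x < fromℕ (suc k))
  floor     zero    0≤x x<0   = ⊥-elim (≤⇒≯ 0≤x x<0)
  floor {x} (suc n) 0≤x x<n+1 with ≤-<-connex (fromℕ n) x
  ... | inj₁ n≤x = n , n≤x , x<n+1
  ... | inj₂ x<n = floor n 0≤x x<n

  -- Indexed by three naturals, so that a union over all rationals becomes three nested unions over
  -- `ℕ`.
  rational : ℕ → ℕ → ℕ → Carrier
  rational m k l = (fromℕ k - fromℕ l) / fromℕ (suc m)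

  archimedean⁻¹ : ∀ {ε} → 0# < ε → ∃[ m ] (1# < fromℕ (suc m) * ε)
  archimedean⁻¹ {ε} 0<ε with m , ε⁻¹<m ← archimedean (ε ⁻¹) = m , (begin-strict
    1#                   ≈⟨ x*x⁻¹≈1 0<ε ⟨
    ε * ε ⁻¹             ≤⟨ *-monoʳ-≤ (<⇒≤ 0<ε) (<⇒≤ ε⁻¹<m) ⟩
    ε * fromℕ m          <⟨ <-by ε 0<ε (solve 2 (λ e n → e :* (:1 :+ n) :- e :* n := e) refl ε (fromℕ m)) ⟩
    ε * fromℕ (suc m)    ≈⟨ *-comm _ _ ⟩
    fromℕ (suc m) * ε    ∎)

  -- With `n = fromℕ (suc m)` and `k` the floor of `n * x + l`, the numerator `(k + 1) - l` exceeds
  -- `n * x` by at most one, while `n * y` exceeds it by more than one.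
  rational-between : ∀ {x y} m k l → 1# < fromℕ (suc m) * (y - x) →
    fromℕ k ≤ fromℕ (suc m) * x + fromℕ l → fromℕ (suc m) * x + fromℕ l < fromℕ (suc k) →
    x < rational m (suc k) l × rational m (suc k) l < y
  rational-between {x} {y} m k l 1<n*[y-x] k≤nx+l nx+l<k+1 =
    *-cancelˡ-< 0<n (begin-strict
      n * x                       <⟨ <-by _ (x<y⇒0<y-x nx+l<k+1)
                                      (solve 3 (λ k l a → (k :- l) :- a := k :- (a :+ l)) refl
                                        (fromℕ (suc k)) (fromℕ l) (n * x)) ⟩
      fromℕ (suc k) - fromℕ l     ≈⟨ y*[x/y]≈x _ 0<n ⟨
      n * rational m (suc k) l    ∎) ,
    *-cancelˡ-< 0<n (begin-strict
      n * rational m (suc k) l    ≈⟨ y*[x/y]≈x _ 0<n ⟩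
      fromℕ (suc k) - fromℕ l     ≤⟨ ≤-by _ (x≤y⇒0≤y-x k≤nx+l)
                                      (solve 3 (λ k l a → (:1 :+ a) :- ((:1 :+ k) :- l) := (a :+ l) :- k) refl
                                        (fromℕ k) (fromℕ l) (n * x)) ⟩
      1# + n * x                  <⟨ <-by _ (x<y⇒0<y-x 1<n*[y-x])
                                      (solve 3 (λ n x y → n :* y :- (:1 :+ n :* x) := n :* (y :- x) :- :1) refl n x y) ⟩
      n * y                       ∎)
    where
    n   = fromℕ (suc m)
    0<n = 0<fromℕ-suc m

  dense : ∀ {x y} → x < y → ∃[ m ] ∃[ k ] ∃[ l ] (x < rational m k l × rational m k l < y)
  dense {x} {y} x<y =
    let m , 1<n*[y-x]           = archimedean⁻¹ (x<y⇒0<y-x x<y)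
        -- Adding `l` makes `n * x` nonnegative, as `floor` requires.
        l , -nx<l               = archimedean (- (fromℕ (suc m) * x))
        k′ , nx+l<k′            = archimedean (fromℕ (suc m) * x + fromℕ l)
        k , k≤nx+l , nx+l<k+1   = floor k′ (-a<b⇒0≤a+b (fromℕ (suc m) * x) (fromℕ l) -nx<l) nx+l<k′
    in m , suc k , l , rational-between m k l 1<n*[y-x] k≤nx+l nx+l<k+1
    where
    -a<b⇒0≤a+b : ∀ a b → - a < b → 0# ≤ a + b
    -a<b⇒0≤a+b a b -a<b = ≤-by _ (x≤y⇒0≤y-x (<⇒≤ -a<b))
      (solve 2 (λ a b → (a :+ b) :- :0 := b :- (:- a)) refl a b)

  -- Gives the index at which a point of an open ray enters the union of closed rays that exhausts
  -- it.
  <⇒≤-reciprocal : ∀ {x y} → x < y → ∃[ m ] (x ≤ y - fromℕ (suc m) ⁻¹)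
  <⇒≤-reciprocal {x} {y} x<y =
    let m , 1<n*[y-x] = archimedean⁻¹ (x<y⇒0<y-x x<y)
    in m , x≤y-n⁻¹ (0<fromℕ-suc m) 1<n*[y-x]
    where
    x≤y-n⁻¹ : ∀ {n} → 0# < n → 1# < n * (y - x) → x ≤ y - n ⁻¹
    x≤y-n⁻¹ {n} 0<n 1<n*[y-x] = ≤-by ((y - x) - n ⁻¹)
      (x≤y⇒0≤y-x (*-cancelˡ-≤ 0<n (begin
        n * n ⁻¹       ≈⟨ x*x⁻¹≈1 0<n ⟩
        1#             ≤⟨ <⇒≤ 1<n*[y-x] ⟩
        n * (y - x)    ∎)))
      (solve 3 (λ x y z → (y :- z) :- x := (y :- x) :- z) refl x y (n ⁻¹))

-- Half-lines and points as Borel sets.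

module BorelSets (em : ExcludedMiddle 0ℓ) (ℝ : CompleteOrderedField) where
  open OrderedField em ℝ
  open Density em ℝ
  open Probability ℝ

  Borel-< : ∀ y → Borel (λ x → x < y)
  Borel-< y = resp ((λ (m , x≤) → below m x≤) , <⇒≤-reciprocal)
    (union (λ m x → x ≤ y - fromℕ (suc m) ⁻¹) (λ m → ray (y - fromℕ (suc m) ⁻¹)))
    where
    below : ∀ m {x} → x ≤ y - fromℕ (suc m) ⁻¹ → x < y
    below m {x} x≤ = begin-strict
      x                        ≤⟨ x≤ ⟩
      y - fromℕ (suc m) ⁻¹     <⟨ <-by (fromℕ (suc m) ⁻¹) (0<x⁻¹ (0<fromℕ-suc m))
                                   (solve 2 (λ y z → y :- (y :- z) := z) refl y (fromℕ (suc m) ⁻¹)) ⟩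
      y                        ∎

  Borel-≥ : ∀ y → Borel (λ x → y ≤ x)
  Borel-≥ y = resp (≮⇒≥ , ≤⇒≯) (complement (Borel-< y))

  -- A point is what two open rays leave over. Since `union` takes a sequence, every index past zero
  -- repeats the second ray.
  Borel-singleton : ∀ y → Borel (λ x → x ≈ y)
  Borel-singleton y = resp
    ( (λ {x} ¬outside → antisym (≮⇒≥ λ y<x → ¬outside (1 , λ x≤y → ≤⇒≯ x≤y y<x))
                                 (≮⇒≥ λ x<y → ¬outside (0 , x<y)))
    , (λ { x≈y (zero , x<y) → proj₂ x<y x≈y ; x≈y (suc _ , x≰y) → x≰y (≤-reflexive x≈y) }))
    (complement (union outside outside-Borel))
    where
    outside : ℕ → Pred Carrier 0ℓ
    outside zero    x = x < y
    outside (suc _) x = ¬ (x ≤ y)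

    outside-Borel : ∀ i → Borel (outside i)
    outside-Borel zero    = Borel-< y
    outside-Borel (suc _) = complement (ray y)

-- Finite additivity, the splitting into cells, and measurability of sums.

module Measure (em : ExcludedMiddle 0ℓ) (ℝ : CompleteOrderedField) (𝒫 : Probability.ProbabilitySpace ℝ) where
  open OrderedField em ℝ
  open Limits em ℝ
  open Series em ℝ
  open Density em ℝ
  open Probability ℝ
  open ProbabilitySpace 𝒫

  ¬¬-elim : ∀ {Q : Set} → ¬ ¬ Q → Q
  ¬¬-elim = em⇒dne em

  Event-∅ : Event ∅
  Event-∅ = Event-resp ((λ ¬⊤ → ¬⊤ _) , λ ()) (Event-complement Event-U)

  Event-const : (Q : Set) → Event (λ _ → Q)
  Event-const Q with em {Q}
  ... | yes q = Event-resp ((λ _ → q) , λ _ → _) Event-U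
  ... | no ¬q = Event-resp ((λ ()) , ¬q) Event-∅

  Event-∪ : ∀ {A B} → Event A → Event B → Event (A ∪ B)
  Event-∪ {A} {B} EA EB = Event-resp
    ( (λ { (zero , a) → inj₁ a ; (suc _ , b) → inj₂ b })
    , (λ { (inj₁ a) → zero , a ; (inj₂ b) → 1 , b }))
    (Event-union F (λ { zero → EA ; (suc _) → EB }))
    where
    F : ℕ → Pred Ω 0ℓ
    F zero    = A
    F (suc _) = B

  Event-∩ : ∀ {A B} → Event A → Event B → Event (A ∩ B)
  Event-∩ EA EB = Event-resp
    ( (λ ¬outside → ¬¬-elim (λ ¬a → ¬outside (inj₁ ¬a)) , ¬¬-elim (λ ¬b → ¬outside (inj₂ ¬b)))
    , (λ { (a , b) (inj₁ ¬a) → ¬a a ; (a , b) (inj₂ ¬b) → ¬b b }))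
    (Event-complement (Event-∪ (Event-complement EA) (Event-complement EB)))

  Event-⋂ : ∀ n {A : Fin n → Pred Ω 0ℓ} → (∀ i → Event (A i)) → Event (λ ω → ∀ i → A i ω)
  Event-⋂ zero    EA = Event-resp ((λ _ ()) , λ _ → _) Event-U
  Event-⋂ (suc n) EA = Event-resp
    ( (λ { (a , as) zero → a ; (a , as) (suc i) → as i })
    , (λ as → as zero , λ i → as (suc i)))
    (Event-∩ (EA zero) (Event-⋂ n (λ i → EA (suc i))))

  -- For the constant sequence `∅` the partial sums are the multiples of `P ∅` and increase to `P ∅`
  -- itself. Already the second one gives `2 P ∅ ≤ P ∅`.
  P-∅ : P ∅ ≈ 0#
  P-∅ = antisym (≤-by _ (x≤y⇒0≤y-x 2c≤c) (solve 1 (λ c → :0 :- c := c :- (c :+ (c :+ :0))) refl (P ∅)))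
                (P-nonNeg Event-∅)
    where
    2c≤c : ∑< 2 (λ _ → P ∅) ≤ P ∅
    2c≤c = ≤-trans
      (⟶-≥ 2 (P-σ-additive (λ _ → ∅) (λ _ → Event-∅) (λ _ _ _ ())) (λ n 2≤n →
        ∑<-monoˡ-≤ (λ _ → P-nonNeg Event-∅) 2≤n))
      (≤-reflexive (P-cong (Event-union (λ _ → ∅) (λ _ → Event-∅)) ((λ ()) , λ ())))

  -- The pair is padded with `∅`, which keeps the sequence disjoint, and by `P-∅` the partial sums
  -- are constant from index 2 on.
  P-∪ : ∀ {A B} → Event A → Event B → A ⊥ B → P (A ∪ B) ≈ P A + P B
  P-∪ {A} {B} EA EB A⊥B = ⟶-unique
    (⟶-resp (λ _ → refl) (P-cong (Event-union F EF)
        ( (λ { (0 , a) → inj₁ a ; (1 , b) → inj₂ b ; (suc (suc _) , ()) })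
        , (λ { (inj₁ a) → 0 , a ; (inj₂ b) → 1 , b })))
      (P-σ-additive F EF F-disjoint))
    (⟶-eventually 2 partial-sum)
    where
    F : ℕ → Pred Ω 0ℓ
    F 0             = A
    F 1             = B
    F (suc (suc _)) = ∅

    EF : ∀ i → Event (F i)
    EF 0             = EA
    EF 1             = EB
    EF (suc (suc _)) = Event-∅

    F-disjoint : ∀ i j → i ≢ j → F i ⊥ F j
    F-disjoint 0             0             i≢j _       = i≢j ≡.refl
    F-disjoint 0             1             i≢j (a , b) = A⊥B (a , b)
    F-disjoint 1             0             i≢j (b , a) = A⊥B (a , b)
    F-disjoint 1             1             i≢j _       = i≢j ≡.refl
    F-disjoint (suc (suc _)) _             i≢j (() , _)
    F-disjoint 0             (suc (suc _)) i≢j (_ , ())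
    F-disjoint 1             (suc (suc _)) i≢j (_ , ())

    ∑<-∅ : ∀ n → ∑< n (λ _ → P ∅) ≈ 0#
    ∑<-∅ zero    = refl
    ∑<-∅ (suc n) = trans (+-cong P-∅ (∑<-∅ n)) (+-identityʳ 0#)

    partial-sum : ∀ n → 2 ℕ.≤ n → ∑< n (λ i → P (F i)) ≈ P A + P B
    partial-sum (suc (suc n)) (s≤s (s≤s _)) = +-congˡ (trans (+-congˡ (∑<-∅ n)) (+-identityʳ (P B)))

  P-mono : ∀ {A B} → Event A → Event B → A ⊆ B → P A ≤ P B
  P-mono {A} {B} EA EB A⊆B = begin
    P A                   ≤⟨ ≤-by _ (P-nonNeg EB∖A) (solve 2 (λ a b → (a :+ b) :- a := b) refl _ _) ⟩
    P A + P (B ∩ ∁ A)     ≈⟨ P-∪ EA EB∖A (λ (a , _ , ¬a) → ¬a a) ⟨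
    P (A ∪ (B ∩ ∁ A))     ≈⟨ P-cong (Event-∪ EA EB∖A) ((λ { (inj₁ a) → A⊆B a ; (inj₂ (b , _)) → b }) , split) ⟩
    P B                   ∎
    where
    EB∖A : Event (B ∩ ∁ A)
    EB∖A = Event-∩ EB (Event-complement EA)

    split : B ⊆ A ∪ (B ∩ ∁ A)
    split {ω} b with em {A ω}
    ... | yes a = inj₁ a
    ... | no ¬a = inj₂ (b , ¬a)

  -- The sets `B` and `C` need not cover `Ω`, but together they carry the total mass, so the
  -- remainder `N` has probability zero.
  P-split : ∀ {A B C} → Event A → Event B → Event C → B ⊥ C → P B + P C ≈ 1# → P A ≤ P (A ∩ B) + P (A ∩ C)
  P-split {A} {B} {C} EA EB EC B⊥C PB+PC≈1 = begin
    P A                                ≤⟨ P-mono EA (Event-∪ EA∩[B∪C] EN) cover ⟩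
    P (((A ∩ B) ∪ (A ∩ C)) ∪ N)        ≈⟨ P-∪ EA∩[B∪C] EN (λ { (inj₁ (_ , b) , ¬bc) → ¬bc (inj₁ b)
                                                              ; (inj₂ (_ , c) , ¬bc) → ¬bc (inj₂ c) }) ⟩
    P ((A ∩ B) ∪ (A ∩ C)) + P N        ≈⟨ +-cong (P-∪ EA∩B EA∩C (λ ((_ , b) , _ , c) → B⊥C (b , c))) PN≈0 ⟩
    P (A ∩ B) + P (A ∩ C) + 0#         ≈⟨ +-identityʳ _ ⟩
    P (A ∩ B) + P (A ∩ C)              ∎
    where
    N = ∁ (B ∪ C)
    EB∪C = Event-∪ EB EC
    EN = Event-complement EB∪C
    EA∩B = Event-∩ EA EB
    EA∩C = Event-∩ EA EC
    EA∩[B∪C] = Event-∪ EA∩B EA∩C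

    cover : A ⊆ ((A ∩ B) ∪ (A ∩ C)) ∪ N
    cover {ω} a with em {B ω ⊎ C ω}
    ... | yes (inj₁ b) = inj₁ (inj₁ (a , b))
    ... | yes (inj₂ c) = inj₁ (inj₂ (a , c))
    ... | no  ¬bc      = inj₂ ¬bc

    everything : U ⊆ (B ∪ C) ∪ N
    everything {ω} _ with em {B ω ⊎ C ω}
    ... | yes bc = inj₁ bc
    ... | no ¬bc = inj₂ ¬bc

    PN≈0 : P N ≈ 0#
    PN≈0 = begin-equality
      P N                          ≈⟨ solve 2 (λ n b → n := (b :+ n) :- b) refl (P N) 1# ⟩
      (1# + P N) - 1#              ≈⟨ +-congʳ (+-congʳ (trans (P-∪ EB EC B⊥C) PB+PC≈1)) ⟨
      (P (B ∪ C) + P N) - 1#       ≈⟨ +-congʳ (P-∪ EB∪C EN (λ (bc , ¬bc) → ¬bc bc)) ⟨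
      P ((B ∪ C) ∪ N) - 1#         ≈⟨ +-congʳ (P-cong Event-U (everything , λ _ → _)) ⟨
      P U - 1#                     ≈⟨ +-congʳ P-U ⟩
      1# - 1#                      ≈⟨ -‿inverseʳ 1# ⟩
      0#                           ∎

  -- Almost every ω lies in exactly one of the sets ⋂ᵢ B i (s i), and the weights
  -- ∏ᵢ w (s i) of these sets add up to 1.
  P-union-bound : ∀ n (B : Fin n → Bool → Pred Ω 0ℓ) → (∀ i b → Event (B i b)) →
    (∀ i → B i true ⊥ B i false) → (∀ i → P (B i true) + P (B i false) ≈ 1#) →
    (w : Bool → Carrier) → w true + w false ≈ 1# →
    ∀ {A} → Event A → ∀ c →
    (∀ (s : Fin n → Bool) → P (A ∩ (λ ω → ∀ i → B i (s i) ω)) ≤ c * product (λ i → w (s i))) →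
    P A ≤ c
  P-union-bound zero    B EB B⊥B ∑B w ∑w {A} EA c bound = begin
    P A                              ≈⟨ P-cong EA ((λ a → a , λ ()) , proj₁) ⟩
    P (A ∩ (λ ω → ∀ i → B i _ ω))    ≤⟨ bound (λ ()) ⟩
    c * 1#                           ≈⟨ *-identityʳ c ⟩
    c                                ∎
  P-union-bound (suc n) B EB B⊥B ∑B w ∑w {A} EA c bound = begin
    P A                                            ≤⟨ P-split EA (EB zero true) (EB zero false) (B⊥B zero) (∑B zero) ⟩
    P (A ∩ B zero true) + P (A ∩ B zero false)     ≤⟨ +-mono-≤ (restricted true) (restricted false) ⟩
    c * w true + c * w false                       ≈⟨ distribˡ c (w true) (w false) ⟨
    c * (w true + w false)                         ≈⟨ *-congˡ ∑w ⟩
    c * 1#                                         ≈⟨ *-identityʳ c ⟩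
    c                                              ∎
    where
    -- Fixing the first coordinate cuts `A` down to `B zero b` and scales the constant by `w b`;
    -- this is why `A` and `c` are arbitrary in the induction.
    restricted : ∀ b → P (A ∩ B zero b) ≤ c * w b
    restricted b = P-union-bound n (B ∘ suc) (EB ∘ suc) (B⊥B ∘ suc) (∑B ∘ suc) w ∑w
      (Event-∩ EA (EB zero b)) (c * w b) λ s → begin
        P ((A ∩ B zero b) ∩ (λ ω → ∀ i → B (suc i) (s i) ω))
          ≈⟨ P-cong (Event-∩ (Event-∩ EA (EB zero b)) (Event-⋂ n (λ i → EB (suc i) (s i))))
               ( (λ { ((a , b₀) , bs) → a , λ { zero → b₀ ; (suc i) → bs i } })
               , (λ { (a , bs) → (a , bs zero) , λ i → bs (suc i) })) ⟩
        P (A ∩ (λ ω → ∀ i → B i ((b ∷ s) i) ω))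
          ≤⟨ bound (b ∷ s) ⟩
        c * (w b * product (λ i → w (s i)))
          ≈⟨ *-assoc c (w b) _ ⟨
        c * w b * product (λ i → w (s i)) ∎

  -- Only rays are tested, which is what can be checked for a sum. All Borel sets follow by
  -- induction on their generation, as preimages commute with complements and unions.
  Measurable : (Ω → Carrier) → Set₁
  Measurable f = ∀ x → Event (λ ω → f ω ≤ x)

  Measurable-> : ∀ {f} → Measurable f → ∀ x → Event (λ ω → x < f ω)
  Measurable-> {f} Mf x = Event-resp ((λ ¬f≤x → ¬¬-elim λ f≤x → ¬f≤x (≮⇒≥ f≤x)) , λ x<f f≤x → ≤⇒≯ f≤x x<f)
    (Event-complement (Mf x))

  -- The sum exceeds `x` exactly when some rational `q` satisfies `q < f ω` and `x - q < g ω`,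
  -- namely one between `x - g ω` and `f ω`. The preimage of the ray is the complement of this
  -- countable union.
  Measurable-+ : ∀ {f g} → Measurable f → Measurable g → Measurable (λ ω → f ω + g ω)
  Measurable-+ {f} {g} Mf Mg x = Event-resp
    ( (λ {ω} none → ≮⇒≥ λ x<f+g → none (separated ω x<f+g))
    , (λ { {ω} f+g≤x (m , k , l , q<f , x-q<g) → ≤⇒≯ f+g≤x (x<u+v q<f x-q<g) }))
    (Event-complement
      (Event-union (λ m ω → ∃[ k ] ∃[ l ] Above (rational m k l) ω) λ m →
       Event-union (λ k ω → ∃[ l ] Above (rational m k l) ω) λ k →
       Event-union (λ l → Above (rational m k l)) λ l →
       Event-∩ (Measurable-> Mf (rational m k l)) (Measurable-> Mg (x - rational m k l))))
    where
    Above : Carrier → Pred Ω 0ℓ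
    Above q ω = q < f ω × x - q < g ω

    x<u+v : ∀ {q u v} → q < u → x - q < v → x < u + v
    x<u+v {q} {u} {v} q<u x-q<v = <-by ((v - (x - q)) + (u - q))
      (+-pos-nonNeg (x<y⇒0<y-x x-q<v) (<⇒≤ (x<y⇒0<y-x q<u)))
      (solve 4 (λ q u v x → (u :+ v) :- x := (v :- (x :- q)) :+ (u :- q)) refl q u v x)

    x-v<u : ∀ {u v} → x < u + v → x - v < u
    x-v<u {u} {v} x<u+v = <-by ((u + v) - x) (x<y⇒0<y-x x<u+v)
      (solve 3 (λ u v x → u :- (x :- v) := (u :+ v) :- x) refl u v x)

    x-q<v : ∀ {q v} → x - v < q → x - q < v
    x-q<v {q} {v} x-v<q = <-by (q - (x - v)) (x<y⇒0<y-x x-v<q)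
      (solve 3 (λ q v x → v :- (x :- q) := q :- (x :- v)) refl q v x)

    separated : ∀ ω → x < f ω + g ω → ∃[ m ] ∃[ k ] ∃[ l ] Above (rational m k l) ω
    separated ω x<f+g =
      let m , k , l , x-g<q , q<f = dense (x-v<u x<f+g)
      in m , k , l , q<f , x-q<v x-g<q

  Measurable-sum : ∀ n (X : Fin n → Ω → Carrier) → (∀ i → Measurable (X i)) →
                   Measurable (λ ω → sum (λ i → X i ω))
  -- The empty sum does not depend on `ω`, so the event is all of `Ω` or empty.
  Measurable-sum zero    X MX x = Event-const (0# ≤ x)
  Measurable-sum (suc n) X MX   = Measurable-+ (MX zero) (Measurable-sum n (X ∘ suc) (MX ∘ suc))

  Measurable⇒IsRandomVariable : ∀ {f} → Measurable f → IsRandomVariable 𝒫 f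
  Measurable⇒IsRandomVariable Mf (ray x)                = Mf x
  Measurable⇒IsRandomVariable Mf (complement B)         = Event-complement (Measurable⇒IsRandomVariable Mf B)
  Measurable⇒IsRandomVariable Mf (union A B)            = Event-union _ (λ i → Measurable⇒IsRandomVariable Mf (B i))
  Measurable⇒IsRandomVariable Mf (resp (A⊆B , B⊆A) B)  = Event-resp (A⊆B , B⊆A) (Measurable⇒IsRandomVariable Mf B)

-- Change of measure and the Chernoff bound.

module Chernoff (em : ExcludedMiddle 0ℓ) (ℝ : CompleteOrderedField) where
  open OrderedField em ℝ
  open Exponential em ℝ
  open Analysis em ℝ
  open Exp semiring using (^-congˡ)
  open Sum semiring using (sum-cong-≋)

  product-cong : ∀ n {x y : Fin n → Carrier} → (∀ i → x i ≈ y i) → product x ≈ product y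
  product-cong zero    x≈y = refl
  product-cong (suc n) x≈y = *-cong (x≈y zero) (product-cong n (x≈y ∘ suc))

  product-nonNeg : ∀ n {x : Fin n → Carrier} → (∀ i → 0# ≤ x i) → 0# ≤ product x
  product-nonNeg zero    0≤x = 0≤1
  product-nonNeg (suc n) 0≤x = *-nonNeg (0≤x zero) (product-nonNeg n (0≤x ∘ suc))

  product-*-exp : ∀ n {x y z : Fin n → Carrier} → (∀ i → x i ≈ y i * exp (- z i)) →
                  product x ≈ product y * exp (- sum z)
  product-*-exp zero    x≈y*exp = begin-equality
    1#                ≈⟨ *-identityˡ 1# ⟨
    1# * 1#           ≈⟨ *-congˡ exp-0 ⟨
    1# * exp 0#       ≈⟨ *-congˡ (exp-cong -0#≈0#) ⟨
    1# * exp (- 0#)   ∎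
  product-*-exp (suc n) {x} {y} {z} x≈y*exp = begin-equality
    x zero * product (x ∘ suc)
      ≈⟨ *-cong (x≈y*exp zero) (product-*-exp n (x≈y*exp ∘ suc)) ⟩
    y zero * exp (- z zero) * (product (y ∘ suc) * exp (- sum (z ∘ suc)))
      ≈⟨ solve 4 (λ a b c d → a :* b :* (c :* d) := a :* c :* (b :* d)) refl _ _ _ _ ⟩
    y zero * product (y ∘ suc) * (exp (- z zero) * exp (- sum (z ∘ suc)))
      ≈⟨ *-congˡ (exp-+ (- z zero) (- sum (z ∘ suc))) ⟨
    y zero * product (y ∘ suc) * exp (- z zero - sum (z ∘ suc))
      ≈⟨ *-congˡ (exp-cong (solve 2 (λ a b → (:- a) :- b := :- (a :+ b)) refl (z zero) (sum (z ∘ suc)))) ⟩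
    y zero * product (y ∘ suc) * exp (- (z zero + sum (z ∘ suc))) ∎

  sum-affine : ∀ n {x y : Fin n → Carrier} a b → (∀ i → y i ≈ a * x i + b) →
               sum y ≈ a * sum x + b * fromℕ n
  sum-affine zero    a b y≈ = solve 2 (λ a b → :0 := a :* :0 :+ b :* :0) refl a b
  sum-affine (suc n) {x} {y} a b y≈ = begin-equality
    y zero + sum (y ∘ suc)
      ≈⟨ +-cong (y≈ zero) (sum-affine n a b (y≈ ∘ suc)) ⟩
    (a * x zero + b) + (a * sum (x ∘ suc) + b * fromℕ n)
      ≈⟨ solve 5 (λ a b x s n → (a :* x :+ b) :+ (a :* s :+ b :* n) := a :* (x :+ s) :+ b :* (:1 :+ n)) refl
           a b (x zero) (sum (x ∘ suc)) (fromℕ n) ⟩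
    a * (x zero + sum (x ∘ suc)) + b * (1# + fromℕ n) ∎

  -- Since `exp` is injective, it suffices that the exponentials of both sides are inverse to
  -- `exp (ln (y / x))`.
  ln-reciprocal : ∀ {x y} → 0# < x → 0# < y → ln (x / y) ≈ - ln (y / x)
  ln-reciprocal {x} {y} 0<x 0<y = exp-injective (*-cancelˡ (exp-pos (ln (y / x))) (begin-equality
    exp (ln (y / x)) * exp (ln (x / y))     ≈⟨ *-cong (exp-ln (/-pos 0<y 0<x)) (exp-ln (/-pos 0<x 0<y)) ⟩
    y / x * (x / y)                         ≈⟨ solve 4 (λ x y u v → y :* u :* (x :* v) := x :* u :* (y :* v)) refl
                                                 x y (x ⁻¹) (y ⁻¹) ⟩
    x * x ⁻¹ * (y * y ⁻¹)                   ≈⟨ *-cong (x*x⁻¹≈1 0<x) (x*x⁻¹≈1 0<y) ⟩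
    1# * 1#                                 ≈⟨ *-identityʳ 1# ⟩
    1#                                      ≈⟨ exp*exp-neg (ln (y / x)) ⟨
    exp (ln (y / x)) * exp (- ln (y / x))   ∎))

  -- Change of measure for one coordinate: the weight `y` under `b(p)` is the weight `x` under
  -- `b(r)` times the exponential of minus the log-likelihood ratio.
  y≈x*exp[-ln[x/y]] : ∀ {x y} → 0# < x → 0# < y → y ≈ x * exp (- ln (x / y))
  y≈x*exp[-ln[x/y]] {x} {y} 0<x 0<y = begin-equality
    y                            ≈⟨ y*[x/y]≈x y 0<x ⟨
    x * (y / x)                  ≈⟨ *-congˡ (exp-ln (/-pos 0<y 0<x)) ⟨
    x * exp (ln (y / x))         ≈⟨ *-congˡ (exp-cong (ln-reciprocal 0<y 0<x)) ⟩
    x * exp (- ln (x / y))       ∎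

  -- The number `1#` separates the two quotients. It is applied to `(1# - r) / (1# - p)` and
  -- `r / p`.
  ln[x/y]≤ln[z/w] : ∀ {x y z w} → 0# < x → 0# < y → 0# < z → 0# < w → x ≤ y → w ≤ z → ln (x / y) ≤ ln (z / w)
  ln[x/y]≤ln[z/w] {x} {y} {z} {w} 0<x 0<y 0<z 0<w x≤y w≤z = exp-cancel-≤ (begin
    exp (ln (x / y))   ≈⟨ exp-ln (/-pos 0<x 0<y) ⟩
    x / y              ≤⟨ *-cancelˡ-≤ 0<y (begin
      y * (x / y)        ≈⟨ y*[x/y]≈x x 0<y ⟩
      x                  ≤⟨ x≤y ⟩
      y                  ≈⟨ *-identityʳ y ⟨
      y * 1#             ∎) ⟩
    1#                 ≤⟨ *-cancelˡ-≤ 0<w (begin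
      w * 1#             ≈⟨ *-identityʳ w ⟩
      w                  ≤⟨ w≤z ⟩
      z                  ≈⟨ y*[x/y]≈x z 0<w ⟨
      w * (z / w)        ∎) ⟩
    z / w              ≈⟨ exp-ln (/-pos 0<z 0<w) ⟨
    exp (ln (z / w))   ∎)

  exp-D : ∀ {p r} → 0# < p → p < 1# → 0# < r → r < 1# → ∀ n →
          exp (- (D[ r ∥ p ] * fromℕ n)) ≈ ((p / r) ^ᴿ r * ((1# - p) / (1# - r)) ^ᴿ (1# - r)) ^ n
  exp-D {p} {r} 0<p p<1 0<r r<1 n = begin-equality
    exp (- (D[ r ∥ p ] * fromℕ n))
      ≈⟨ exp-cong (solve 2 (λ d n → :- (d :* n) := (:- d) :* n) refl D[ r ∥ p ] (fromℕ n)) ⟩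
    exp (- D[ r ∥ p ] * fromℕ n)
      ≈⟨ exp-^ (- D[ r ∥ p ]) n ⟩
    exp (- D[ r ∥ p ]) ^ n
      ≈⟨ ^-congˡ n (exp-cong (negate r (ln (r / p)) (1# - r) (ln ((1# - r) / (1# - p))))) ⟩
    exp (r * - ln (r / p) + (1# - r) * - ln ((1# - r) / (1# - p))) ^ n
      ≈⟨ ^-congˡ n (exp-cong (+-cong (*-congˡ (ln-reciprocal 0<p 0<r)) (*-congˡ (ln-reciprocal 0<1-p 0<1-r)))) ⟨
    exp (r * ln (p / r) + (1# - r) * ln ((1# - p) / (1# - r))) ^ n
      -- By definition of `_^ᴿ_` the two exponentials are the real powers in the next line.
      ≈⟨ ^-congˡ n (exp-+ _ _) ⟩
    ((p / r) ^ᴿ r * ((1# - p) / (1# - r)) ^ᴿ (1# - r)) ^ n ∎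
    where
    0<1-p = x<y⇒0<y-x p<1
    0<1-r = x<y⇒0<y-x r<1

    negate : ∀ r a s b → - (r * a + s * b) ≈ r * - a + s * - b
    negate = solve 4 (λ r a s b → :- (r :* a :+ s :* b) := r :* (:- a) :+ s :* (:- b)) refl

  bernoulli : Carrier → Bool → Carrier
  bernoulli p true  = p
  bernoulli p false = 1# - p

  bit : Bool → Carrier
  bit true  = 1#
  bit false = 0#

  bernoulli-pos : ∀ {p} → 0# < p → p < 1# → ∀ b → 0# < bernoulli p b
  bernoulli-pos 0<p p<1 true  = 0<p
  bernoulli-pos 0<p p<1 false = x<y⇒0<y-x p<1

  -- The log-likelihood ratio ∑ᵢ ℓ (s i) of b(r) against b(p) is affine and
  -- increasing in the number of ones.
  change-of-measure : ∀ {p r} → 0# < p → p < r → r < 1# → ∀ n (s : Fin n → Bool) →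
    r * fromℕ n ≤ sum (λ i → bit (s i)) →
    product (λ i → bernoulli p (s i)) ≤ exp (- (D[ r ∥ p ] * fromℕ n)) * product (λ i → bernoulli r (s i))
  change-of-measure {p} {r} 0<p p<r r<1 n s rn≤∑s = begin
    product (λ i → bernoulli p (s i))
      ≈⟨ product-*-exp n (λ i → y≈x*exp[-ln[x/y]] (0<w (s i)) (bernoulli-pos 0<p p<1 (s i))) ⟩
    product (λ i → bernoulli r (s i)) * exp (- sum (λ i → ℓ (s i)))
      ≤⟨ *-monoʳ-≤ (product-nonNeg n (λ i → <⇒≤ (0<w (s i)))) (exp-mono-≤ (-‿mono-≤ Dn≤∑ℓ)) ⟩
    product (λ i → bernoulli r (s i)) * exp (- (D[ r ∥ p ] * fromℕ n))
      ≈⟨ *-comm _ _ ⟩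
    exp (- (D[ r ∥ p ] * fromℕ n)) * product (λ i → bernoulli r (s i)) ∎
    where
    0<r : 0# < r
    0<r = <-trans 0<p p<r

    p<1 : p < 1#
    p<1 = <-trans p<r r<1

    0<w = bernoulli-pos 0<r r<1

    ℓ : Bool → Carrier
    ℓ b = ln (bernoulli r b / bernoulli p b)

    affine : ∀ b → ℓ b ≈ (ℓ true - ℓ false) * bit b + ℓ false
    affine true  = solve 2 (λ a b → a := (a :- b) :* :1 :+ b) refl (ℓ true) (ℓ false)
    affine false = solve 2 (λ a b → b := (a :- b) :* :0 :+ b) refl (ℓ true) (ℓ false)

    0≤ℓ-ℓ : 0# ≤ ℓ true - ℓ false
    0≤ℓ-ℓ = x≤y⇒0≤y-x (ln[x/y]≤ln[z/w] (0<w false) (bernoulli-pos 0<p p<1 false) 0<r 0<p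
      (+-mono-≤ ≤-refl (-‿mono-≤ (<⇒≤ p<r))) (<⇒≤ p<r))

    -- With `a = ℓ true` and `b = ℓ false`, `D[ r ∥ p ]` unfolds to `r * a + (1# - r) * b`. So
    -- `D[ r ∥ p ] * m` is the value of the affine function of `t` at `t = r * m`, and the gap is
    -- the slope times the excess of ones.
    rearrange : ∀ a b r m t → ((a - b) * t + b * m) - (r * a + (1# - r) * b) * m ≈ (a - b) * (t - r * m)
    rearrange = solve 5 (λ a b r m t →
      ((a :- b) :* t :+ b :* m) :- (r :* a :+ (:1 :- r) :* b) :* m := (a :- b) :* (t :- r :* m)) refl

    Dn≤∑ℓ : D[ r ∥ p ] * fromℕ n ≤ sum (λ i → ℓ (s i))
    Dn≤∑ℓ = begin
      D[ r ∥ p ] * fromℕ n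
        ≤⟨ ≤-by _ (*-nonNeg 0≤ℓ-ℓ (x≤y⇒0≤y-x rn≤∑s))
             (rearrange (ℓ true) (ℓ false) r (fromℕ n) (sum (λ i → bit (s i)))) ⟩
      (ℓ true - ℓ false) * sum (λ i → bit (s i)) + ℓ false * fromℕ n
        ≈⟨ sum-affine n (ℓ true - ℓ false) (ℓ false) (λ i → affine (s i)) ⟨
      sum (λ i → ℓ (s i)) ∎

  module _ (𝒫 : Probability.ProbabilitySpace ℝ) where
    open Probability ℝ
    open ProbabilitySpace 𝒫
    open BorelSets em ℝ
    open Measure em ℝ 𝒫

    chernoff-bound : ∀ {p r} → 0# < p → p < r → r < 1# → ∀ n (X : Fin n → Ω → Carrier) →
      (∀ i → IsRandomVariable 𝒫 (X i)) → Independent 𝒫 X → (∀ i → IsBernoulli 𝒫 p (X i)) →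
      P (λ ω → r * fromℕ n ≤ sum (λ i → X i ω)) ≤ exp (- (D[ r ∥ p ] * fromℕ n))
    chernoff-bound {p} {r} 0<p p<r r<1 n X RV independent X∼b[p] =
      P-union-bound n B EB
        (λ i (X≈1 , X≈0) → 0≉1 (trans (sym X≈0) X≈1))
        (λ i → trans (+-cong (proj₁ (X∼b[p] i)) (proj₂ (X∼b[p] i))) (x+[1-x]≈1 p))
        (bernoulli r) (x+[1-x]≈1 r) EA c cell-bound
      where
      c = exp (- (D[ r ∥ p ] * fromℕ n))

      B : Fin n → Bool → Pred Ω 0ℓ
      B i b ω = X i ω ≈ bit b

      EB : ∀ i b → Event (B i b)
      EB i b = RV i (Borel-singleton (bit b))

      A : Pred Ω 0ℓ
      A ω = r * fromℕ n ≤ sum (λ i → X i ω)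

      EA : Event A
      EA = Measurable⇒IsRandomVariable (Measurable-sum n X (λ i x → RV i (ray x))) (Borel-≥ (r * fromℕ n))

      x+[1-x]≈1 : ∀ x → x + (1# - x) ≈ 1#
      x+[1-x]≈1 = solve 1 (λ x → x :+ (:1 :- x) := :1) refl

      distribution : ∀ i b → P (B i b) ≈ bernoulli p b
      distribution i true  = proj₁ (X∼b[p] i)
      distribution i false = proj₂ (X∼b[p] i)

      0<r : 0# < r
      0<r = <-trans 0<p p<r

      Cell : (Fin n → Bool) → Pred Ω 0ℓ
      Cell s ω = ∀ i → B i (s i) ω

      Event-Cell : ∀ s → Event (Cell s)
      Event-Cell s = Event-⋂ n (λ i → EB i (s i))

      -- On a cell the sum equals the number of ones in `s`. Either that number reaches `r n` and
      -- the whole cell is estimated, or the cell does not meet `A`.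
      cell-bound : ∀ s → P (A ∩ Cell s) ≤ c * product (λ i → bernoulli r (s i))
      cell-bound s with em {r * fromℕ n ≤ sum (λ i → bit (s i))}
      ... | yes rn≤∑s = begin
        P (A ∩ Cell s)                        ≤⟨ P-mono (Event-∩ EA (Event-Cell s)) (Event-Cell s) proj₂ ⟩
        P (Cell s)                            ≈⟨ independent (λ i x → x ≈ bit (s i)) (λ i → Borel-singleton (bit (s i))) ⟩
        product (λ i → P (B i (s i)))         ≈⟨ product-cong n (λ i → distribution i (s i)) ⟩
        product (λ i → bernoulli p (s i))     ≤⟨ change-of-measure 0<p p<r r<1 n s rn≤∑s ⟩
        c * product (λ i → bernoulli r (s i)) ∎
      ... | no rn≰∑s = begin
        P (A ∩ Cell s)                        ≤⟨ P-mono (Event-∩ EA (Event-Cell s)) Event-∅ (λ (rn≤S , X≈s) →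
                                                   rn≰∑s (≤-trans rn≤S (≤-reflexive (sum-cong-≋ {n} X≈s)))) ⟩
        P ∅                                   ≈⟨ P-∅ ⟩
        0#                                    ≤⟨ *-nonNeg (<⇒≤ (exp-pos _)) (product-nonNeg n (λ i →
                                                   <⇒≤ (bernoulli-pos 0<r r<1 (s i)))) ⟩
        c * product (λ i → bernoulli r (s i)) ∎

lemma1 : (em : ExcludedMiddle 0ℓ) (ℝ : CompleteOrderedField) →
  let open CompleteOrderedField ℝ
      open Analysis em ℝ
      open Probability ℝ
  in
  (𝒫 : ProbabilitySpace) →
  let open ProbabilitySpace 𝒫 in
  (p : Carrier) → 0# < p → p < 1# →
  (n : ℕ) → .{{_ : NonZero n}} →
  (X : Fin n → Ω → Carrier) →
  (∀ i → IsRandomVariable 𝒫 (X i)) →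
  Independent 𝒫 X →
  (∀ i → IsBernoulli 𝒫 p (X i)) →
  let S : Ω → Carrier
      S ω = sum (λ i → X i ω)
  in
  (r : Carrier) → p < r → r < 1# →
  P (λ ω → r * fromℕ n ≤ S ω) ≤ exp (- (D[ r ∥ p ] * fromℕ n))
    × exp (- (D[ r ∥ p ] * fromℕ n))
        ≈ ((p / r) ^ᴿ r * ((1# - p) / (1# - r)) ^ᴿ (1# - r)) ^ n
lemma1 em ℝ 𝒫 p 0<p p<1 n X RV independent X∼b[p] r p<r r<1 =
  chernoff-bound 𝒫 0<p p<r r<1 n X RV independent X∼b[p] ,
  exp-D 0<p p<1 (<-trans 0<p p<r) r<1 n
  where
  open OrderedField em ℝ using (<-trans)
  open Chernoff em ℝ
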